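{- Let $d\ge2$ and let $i,j$ be integers with $i\ge1$, $j\ge0$, $j<d-1$ and $i+j\le d-1$. Define $$f_d(i,j,x)=\sum_{k=0}^{d-1} C_{d-1-k}(1-x)^kx^{d-k}\sum_{s=0}^{j}\binom{j}{s}\binom{d+i+j-1-k-s}{k-s},\qquad C_n=\tfrac1{n+1}\tbinom{2n}{n}.$$ Then for every $m$, the coefficient of $x^{d-m}$ in $f_d(i,j,x)$ equals the number of plane trees on $d$ vertices (labeled $1,\ldots,d$ in postorder) having exactly $m$ vertices $v$ with one of the following properties: $v$ is a type $[0]$ special vertex; $v$ is a type $[1]$ special vertex whose postorder label is at most $i$ or at least $d-j$; $v$ is a type $[2]$ special vertex whose postorder label is at least $d-j$.
   Context: A plane tree is a rooted tree in which the children of each vertex are linearly ordered left to right; the first child is the leftmost child; a leaf has no children. Postorder labeling of a plane tree on $n$ vertices: remove the root, label the subtrees rooted at the root's children, left to right, consecutively and each recursively in postorder, then give the root label $n$. Special vertices: $v$ is type $[0]$ if $v$ is a leaf and the leftmost child of its parent; type $[1]$ if $v$ is a leaf and not the leftmost child of its parent; type $[2]$ if $v$ is not a leaf and is the leftmost child of its parent. ($f_d(i,j,x)$ is the contribution of a shelling component of type $(i,j)$ to the toric $f$-polynomial of a shellable $(d-1)$-dimensional cubical complex.) -}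

module Defs where

open import Data.Nat as ℕ using (ℕ; zero; suc; _∸_; _≤?_)
open import Data.Nat.Combinatorics using (_C_)
open import Data.Nat.DivMod using (_/_)
open import Data.Integer as ℤ using (ℤ; +_)
open import Data.List using (List; []; _∷_; map; foldr; upTo; replicate)
open import Data.Bool using (Bool; true; false; if_then_else_; _∨_)
open import Relation.Nullary using (does)

-- Polynomials over ℤ as coefficient lists (ascending powers of x).

Poly : Set
Poly = List ℤ

infixl 6 _+ₚ_
infixl 7 _*ₚ_ _·ₚ_

_+ₚ_ : Poly → Poly → Poly
[] +ₚ q = q
(a ∷ p) +ₚ [] = a ∷ p
(a ∷ p) +ₚ (b ∷ q) = (a ℤ.+ b) ∷ (p +ₚ q)

_·ₚ_ : ℤ → Poly → Poly
c ·ₚ p = map (c ℤ.*_) p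

_*ₚ_ : Poly → Poly → Poly
[] *ₚ q = []
(a ∷ p) *ₚ q = (a ·ₚ q) +ₚ (+ 0 ∷ (p *ₚ q))

constₚ : ℤ → Poly
constₚ c = c ∷ []

Xₚ : Poly
Xₚ = + 0 ∷ + 1 ∷ []

oneMinusX : Poly
oneMinusX = + 1 ∷ ℤ.- (+ 1) ∷ []

_^ₚ_ : Poly → ℕ → Poly
p ^ₚ zero = constₚ (+ 1)
p ^ₚ suc n = p *ₚ (p ^ₚ n)

sumₚ : List Poly → Poly
sumₚ = foldr _+ₚ_ []

coeff : Poly → ℕ → ℤ
coeff [] e = + 0
coeff (a ∷ p) zero = a
coeff (a ∷ p) (suc e) = coeff p e

catalan : ℕ → ℕ
catalan n = ((2 ℕ.* n) C n) / suc n

binomDiff : ℕ → ℕ → ℕ → ℕ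
binomDiff top k s = if does (s ≤? k) then top C (k ∸ s) else 0

-- inner sum  Σ_{s=0}^{j} binom(j,s) binom(d+i+j-1-k-s, k-s)
-- (the top entry d+i+j-1-k-s is nonnegative under the hypotheses)
innerSum : (d i j k : ℕ) → ℕ
innerSum d i j k =
  foldr ℕ._+_ 0
    (map (λ s → (j C s) ℕ.* binomDiff (d ℕ.+ i ℕ.+ j ∸ 1 ∸ k ∸ s) k s) (upTo (suc j)))

f : (d i j : ℕ) → Poly
f d i j = sumₚ (map term (upTo d))
  where
  term : ℕ → Poly
  term k = (+ (catalan (d ∸ 1 ∸ k) ℕ.* innerSum d i j k))
             ·ₚ ((oneMinusX ^ₚ k) *ₚ (Xₚ ^ₚ (d ∸ k)))

data PlaneTree : Set where
  node : List PlaneTree → PlaneTree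

mutual
  size : PlaneTree → ℕ
  size (node cs) = suc (sizes cs)

  sizes : List PlaneTree → ℕ
  sizes [] = 0
  sizes (c ∷ cs) = size c ℕ.+ sizes cs

isLeaf : PlaneTree → Bool
isLeaf (node []) = true
isLeaf (node (_ ∷ _)) = false

-- Whether a non-root vertex is counted, given: is it a leaf, is it the
-- leftmost child of its parent, and its postorder label.
--   type [0]: leaf, leftmost                       -- always counted
--   type [1]: leaf, not leftmost                   -- counted iff label ≤ i or label ≥ d - j
--   type [2]: not a leaf, leftmost                 -- counted iff label ≥ d - j
--   otherwise                                       -- not counted
marked : (d i j : ℕ) → (leaf leftmost : Bool) → (label : ℕ) → ℕ
marked d i j true  true  l = 1
marked d i j true  false l =
  if does (l ≤? i) ∨ does ((d ∸ j) ≤? l) then 1 else 0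
marked d i j false true  l = if does ((d ∸ j) ≤? l) then 1 else 0
marked d i j false false l = 0

-- Postorder labelling: a subtree whose vertices receive labels
-- offset+1, ..., offset+size; its root receives offset+size.
-- The children of a vertex are labelled left to right consecutively.
mutual
  countSub : (d i j : ℕ) → (offset : ℕ) → (leftmost : Bool) → PlaneTree → ℕ
  countSub d i j off lm (node cs) =
    marked d i j (isLeaf (node cs)) lm (off ℕ.+ size (node cs))
    ℕ.+ countChildren d i j off true cs

  countChildren : (d i j : ℕ) → (offset : ℕ) → (leftmost : Bool) → List PlaneTree → ℕ
  countChildren d i j off lm [] = 0
  countChildren d i j off lm (c ∷ cs) =
    countSub d i j off lm c ℕ.+ countChildren d i j (off ℕ.+ size c) false cs

-- number of vertices v of the tree t (labelled 1..size t in postorder)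
-- that are counted in the sense of the theorem (the root is never special)
specialCount : (d i j : ℕ) → PlaneTree → ℕ
specialCount d i j (node cs) = countChildren d i j 0 true cs

{-# OPTIONS --safe #-}

-- Put n = d − 1. Writing xᵈ⁻ᵐ as Σₖ (m C k) (1 − x)ᵏ xᵈ⁻ᵏ reduces the theorem to the
-- binomial moments of the number w of marked vertices: the sum of (w C k) over all plane
-- trees must be catalan (n − k) times the inner sum.
--
-- The moments are computed for sequences of h forests with n vertices in total, by removing
-- the last vertex in postorder. In each of the three ranges of its label (at most i, in
-- between, at least d − j) this gives a linear recurrence in n and h, because deleting a
-- marked leaf or a marked leftmost non-leaf leaves a smaller sequence of forests that is
-- arbitrary except that certain forests are required to be empty. If p of the labels
-- 1, …, n are at most i and l of them are at least d − j, then, with r = n − k, the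
-- recurrences are solved by
-- ballot r h · Σₛ (l C s) ((r + h + p + l − 1 − s) C (k − s)).
module Submission where

open import Defs
open import Data.Nat using (ℕ; zero; suc; _+_; _*_; _∸_; _≤_; _<_; z≤n; s≤s; s≤s⁻¹; _≤?_)
open import Data.Integer using (ℤ; +_)
open import Data.Fin using (Fin; zero; suc)
open import Data.Product using (Σ; ∃; _×_; _,_)
open import Function.Bundles using (_↔_; mk↔ₛ′)
open import Relation.Binary.PropositionalEquality
  using (_≡_; refl; sym; trans; cong; cong₂; subst; module ≡-Reasoning)

open import Algebra.Bundles using (CommutativeMonoid)
import Algebra.Properties.CommutativeMonoid.Mult as Mult
import Algebra.Properties.CommutativeSemigroup as CommutativeSemigroupProperties
open import Data.Bool using (Bool; true; false; if_then_else_; _∨_)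
open import Data.Fin.Properties using (+↔⊎)
import Data.Integer as ℤ
import Data.Integer.Properties as ℤ
import Data.Integer.Tactic.RingSolver as ℤ-Solver
open import Data.List using (List; []; _∷_; _∷ʳ_; applyUpTo; foldr; initLast; InitLast; _∷ʳ′_; map; null; upTo)
open import Data.List.Properties using (map-upTo)
open import Data.Nat.Combinatorics using (_C_; k>n⇒nCk≡0; nC1≡n; nCk≡nC[n∸k]; nCk+nC[k+1]≡[n+1]C[k+1])
open import Data.Nat.DivMod using (_/_; m*n/n≡m)
open import Data.Nat.Properties
open import Data.Nat.Tactic.RingSolver using (solve-∀)
open import Data.Product.Function.Dependent.Propositional using (Σ-↔)
open import Data.Product.Function.NonDependent.Propositional using (_×-↔_)
open import Data.Sum using (_⊎_; inj₁; inj₂)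
open import Data.Sum.Function.Propositional using (_⊎-↔_)
open import Data.Vec using (Vec; []; _∷_; insertAt; lookup)
open import Function using (_∘_)
open import Function.Properties.Inverse using (↔-refl; ↔-sym; ↔-trans)
open import Function.Related.TypeIsomorphisms using (Σ-distribʳ-⊎)
open import Relation.Nullary using (¬_; contradiction; does; no; yes)
open import Relation.Nullary.Decidable using (dec-false; dec-true)

open CommutativeSemigroupProperties +-commutativeSemigroup using (interchange)

-- Binomial sums in a commutative monoid

module BinomialTransform {c ℓ} (M : CommutativeMonoid c ℓ) where
  open CommutativeMonoid M
    using (Carrier; _≈_; _∙_; ε; ∙-cong; ∙-congˡ; ∙-congʳ; identityʳ; setoid; commutativeSemigroup)
    renaming (refl to ≈-refl; sym to ≈-sym; trans to ≈-trans; reflexive to ≈-reflexive;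
              assoc to ∙-assoc; comm to ∙-comm; identityˡ to ε-identityˡ)
  open Mult M using (×-homo-+) renaming (_×_ to _·_)
  open CommutativeSemigroupProperties commutativeSemigroup
    using (x∙yz≈y∙xz) renaming (interchange to ∙-interchange)
  open import Relation.Binary.Reasoning.Setoid setoid

  ∑< : ℕ → (ℕ → Carrier) → Carrier
  ∑< n g = foldr _∙_ ε (applyUpTo g n)

  ∑<-cong : ∀ n {g g′} → (∀ s → s < n → g s ≈ g′ s) → ∑< n g ≈ ∑< n g′
  ∑<-cong zero    eq = ≈-refl
  ∑<-cong (suc n) eq = ∙-cong (eq 0 (s≤s z≤n)) (∑<-cong n λ s s<n → eq (suc s) (s≤s s<n))

  ∑<-ε : ∀ n → ∑< n (λ _ → ε) ≈ ε
  ∑<-ε zero    = ≈-refl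
  ∑<-ε (suc n) = ≈-trans (ε-identityˡ _) (∑<-ε n)

  ∑<-∙ : ∀ n g g′ → ∑< n (λ s → g s ∙ g′ s) ≈ ∑< n g ∙ ∑< n g′
  ∑<-∙ zero    g g′ = ≈-sym (ε-identityˡ ε)
  ∑<-∙ (suc n) g g′ =
    ≈-trans (∙-congˡ (∑<-∙ n (g ∘ suc) (g′ ∘ suc))) (∙-interchange _ _ _ _)

  -- This is Σₛ (l C s) · g s, built by iterating Pascal's rule, so that inductions on `l` involve
  -- no binomial weights. The monoid is abstract because such sums occur over ℕ in the inner sum and
  -- over ℤ in the expansion of powers of x.
  transform : ℕ → (ℕ → Carrier) → Carrier
  transform zero    g = g 0
  transform (suc l) g = transform l g ∙ transform l (g ∘ suc)

  transform-cong : ∀ l {g g′} → (∀ s → s ≤ l → g s ≈ g′ s) → transform l g ≈ transform l g′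
  transform-cong zero    eq = eq 0 z≤n
  transform-cong (suc l) eq =
    ∙-cong (transform-cong l λ s s≤l → eq s (m≤n⇒m≤1+n s≤l))
           (transform-cong l λ s s≤l → eq (suc s) (s≤s s≤l))

  transform-∙ : ∀ l g g′ → transform l (λ s → g s ∙ g′ s) ≈ transform l g ∙ transform l g′
  transform-∙ zero    g g′ = ≈-refl
  transform-∙ (suc l) g g′ =
    ≈-trans (∙-cong (transform-∙ l g g′) (transform-∙ l (g ∘ suc) (g′ ∘ suc)))
            (∙-interchange _ _ _ _)

  transform-ε : ∀ l → transform l (λ _ → ε) ≈ ε
  transform-ε zero    = ≈-refl
  transform-ε (suc l) = ≈-trans (∙-cong (transform-ε l) (transform-ε l)) (ε-identityˡ ε)

  -- Pascal's rule splits the weights into the sums for `g` and `g ∘ suc`. The bound is any `n`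
  -- above `l`, because the induction uses the case `l` at both `n` and `suc n`.
  ∑<-binomial : ∀ l {n} g → l < n → ∑< n (λ s → (l C s) · g s) ≈ transform l g
  ∑<-binomial zero {suc n} g _ = begin
    (g 0 ∙ ε) ∙ ∑< n (λ _ → ε)  ≈⟨ ∙-congˡ (∑<-ε n) ⟩
    (g 0 ∙ ε) ∙ ε               ≈⟨ identityʳ _ ⟩
    g 0 ∙ ε                     ≈⟨ identityʳ _ ⟩
    g 0                         ∎
  ∑<-binomial (suc l) {suc n} g (s≤s l<n) = begin
    (suc l C 0) · g 0 ∙ ∑< n (λ s → (suc l C suc s) · g (suc s))
      ≈⟨ ∙-congˡ (∑<-cong n λ s _ → ≈-trans
           (≈-reflexive (cong (_· g (suc s)) (sym (nCk+nC[k+1]≡[n+1]C[k+1] l s))))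
           (×-homo-+ (g (suc s)) (l C s) (l C suc s))) ⟩
    (l C 0) · g 0 ∙ ∑< n (λ s → (l C s) · g (suc s) ∙ (l C suc s) · g (suc s))
      ≈⟨ ∙-congˡ (∑<-∙ n _ _) ⟩
    (l C 0) · g 0 ∙ (∑< n (λ s → (l C s) · g (suc s)) ∙ ∑< n (λ s → (l C suc s) · g (suc s)))
      ≈⟨ x∙yz≈y∙xz _ _ _ ⟩
    ∑< n (λ s → (l C s) · g (suc s)) ∙ ∑< (suc n) (λ s → (l C s) · g s)
      ≈⟨ ∙-cong (∑<-binomial l (g ∘ suc) l<n) (∑<-binomial l g (m<n⇒m<1+n l<n)) ⟩
    transform l (g ∘ suc) ∙ transform l g
      ≈⟨ ∙-comm _ _ ⟩
    transform l g ∙ transform l (g ∘ suc) ∎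

module ℕ-Sum = BinomialTransform +-0-commutativeMonoid
module ℤ-Sum = BinomialTransform ℤ.+-0-commutativeMonoid

ℕ-×≡* : ∀ n x → Mult._×_ +-0-commutativeMonoid n x ≡ n * x
ℕ-×≡* zero    x = refl
ℕ-×≡* (suc n) x = cong (_+_ x) (ℕ-×≡* n x)

ℤ-×≡* : ∀ n x → Mult._×_ ℤ.+-0-commutativeMonoid n x ≡ + n ℤ.* x
ℤ-×≡* zero    x = refl
ℤ-×≡* (suc n) x = trans (cong (ℤ._+_ x) (ℤ-×≡* n x)) (sym (ℤ.suc-* (+ n) x))

-- The numbers Σₛ (l C s) ((N ∸ s) C (k ∸ s))

shiftedBinomialSum : ℕ → ℕ → ℕ → ℕ
shiftedBinomialSum l N k = ℕ-Sum.transform l (λ s → binomDiff (N ∸ s) k s)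

binomDiff-≤ : ∀ N {k s} → s ≤ k → binomDiff N k s ≡ N C (k ∸ s)
binomDiff-≤ N {k} {s} s≤k = cong (λ b → if b then N C (k ∸ s) else 0) (dec-true (s ≤? k) s≤k)

binomDiff-> : ∀ N {k s} → k < s → binomDiff N k s ≡ 0
binomDiff-> N {k} {s} k<s =
  cong (λ b → if b then N C (k ∸ s) else 0) (dec-false (s ≤? k) (<⇒≱ k<s))

binomDiff-suc-suc : ∀ N k s → binomDiff N (suc k) (suc s) ≡ binomDiff N k s
binomDiff-suc-suc N k s with s ≤? k
... | yes s≤k = trans (binomDiff-≤ N (s≤s s≤k)) (sym (binomDiff-≤ N s≤k))
... | no  s≰k = trans (binomDiff-> N (s≤s (≰⇒> s≰k))) (sym (binomDiff-> N (≰⇒> s≰k)))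

-- Pascal's rule in the lower index k - s. At s = k + 1 the first two terms are 1, and the default
-- value 0 of `binomDiff N k s` is exactly what balances them.
binomDiff-pascal : ∀ N k s →
  binomDiff (suc N) (suc k) s ≡ binomDiff N (suc k) s + binomDiff N k s
binomDiff-pascal N k zero =
  trans (sym (nCk+nC[k+1]≡[n+1]C[k+1] N k)) (+-comm (N C k) (N C suc k))
binomDiff-pascal N zero (suc s) = begin
  binomDiff (suc N) 1 (suc s)  ≡⟨ binomDiff-suc-suc (suc N) 0 s ⟩
  binomDiff (suc N) 0 s        ≡⟨ base s ⟩
  binomDiff N 0 s              ≡⟨ binomDiff-suc-suc N 0 s ⟨
  binomDiff N 1 (suc s)        ≡⟨ +-identityʳ _ ⟨
  binomDiff N 1 (suc s) + 0    ∎
  where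
  open ≡-Reasoning
  base : ∀ s → binomDiff (suc N) 0 s ≡ binomDiff N 0 s
  base zero    = refl
  base (suc s) = refl
binomDiff-pascal N (suc k) (suc s) = begin
  binomDiff (suc N) (2 + k) (suc s)                        ≡⟨ binomDiff-suc-suc (suc N) (suc k) s ⟩
  binomDiff (suc N) (suc k) s                              ≡⟨ binomDiff-pascal N k s ⟩
  binomDiff N (suc k) s + binomDiff N k s
    ≡⟨ cong₂ _+_ (binomDiff-suc-suc N (suc k) s) (binomDiff-suc-suc N k s) ⟨
  binomDiff N (2 + k) (suc s) + binomDiff N (suc k) (suc s) ∎
  where open ≡-Reasoning

shiftedBinomialSum-0 : ∀ l N → shiftedBinomialSum l N 0 ≡ 1
shiftedBinomialSum-0 zero    N = refl
shiftedBinomialSum-0 (suc l) N = cong₂ _+_ (shiftedBinomialSum-0 l N) (ℕ-Sum.transform-ε l)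

-- From s ≤ l ≤ N < k, every summand has its lower index k - s above its upper index N - s.
shiftedBinomialSum-vanish : ∀ l {N k} → l ≤ N → N < k → shiftedBinomialSum l N k ≡ 0
shiftedBinomialSum-vanish l {N} {k} l≤N N<k = trans
  (ℕ-Sum.transform-cong l λ s s≤l →
    let s≤N = ≤-trans s≤l l≤N in
    trans (binomDiff-≤ (N ∸ s) (≤-trans s≤N (<⇒≤ N<k)))
          (k>n⇒nCk≡0 (∸-monoˡ-< N<k s≤N)))
  (ℕ-Sum.transform-ε l)

-- Pascal's rule termwise; `l ≤ N` makes `suc N ∸ s` equal to `suc (N ∸ s)` for every s that occurs.
shiftedBinomialSum-pascal : ∀ l {N} k → l ≤ N →
  shiftedBinomialSum l (suc N) (suc k) ≡ shiftedBinomialSum l N (suc k) + shiftedBinomialSum l N k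
shiftedBinomialSum-pascal l {N} k l≤N = trans
  (ℕ-Sum.transform-cong l λ s s≤l → trans
    (cong (λ n → binomDiff n (suc k) s) (+-∸-assoc 1 (≤-trans s≤l l≤N)))
    (binomDiff-pascal (N ∸ s) k s))
  (ℕ-Sum.transform-∙ l _ _)

-- The second half of `transform (suc l)` shifts s by one, and lowering both N and k by one absorbs
-- this shift.
shiftedBinomialSum-suc : ∀ l N k →
  shiftedBinomialSum (suc l) (suc N) (suc k) ≡
  shiftedBinomialSum l (suc N) (suc k) + shiftedBinomialSum l N k
shiftedBinomialSum-suc l N k = cong (_+_ (shiftedBinomialSum l (suc N) (suc k)))
  (ℕ-Sum.transform-cong l λ s _ → binomDiff-suc-suc (N ∸ s) k s)

innerSum≡shiftedBinomialSum : ∀ d i j k →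
  innerSum d i j k ≡ shiftedBinomialSum j (d + i + j ∸ 1 ∸ k) k
innerSum≡shiftedBinomialSum d i j k = begin
  foldr _+_ 0 (map g (upTo (suc j)))  ≡⟨ cong (foldr _+_ 0) (map-upTo g (suc j)) ⟩
  ℕ-Sum.∑< (suc j) g                  ≡⟨ ℕ-Sum.∑<-cong (suc j) (λ s _ → ℕ-×≡* (j C s) (b s)) ⟨
  _                                   ≡⟨ ℕ-Sum.∑<-binomial j _ (n<1+n j) ⟩
  _                                   ∎
  where
  open ≡-Reasoning
  b g : ℕ → ℕ
  b s = binomDiff (d + i + j ∸ 1 ∸ k ∸ s) k s
  g s = (j C s) * b s

-- Ballot numbers

-- ballot r h counts the sequences of h plane forests with r vertices in total.
ballot : ℕ → ℕ → ℕ
ballot zero    h       = 1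
ballot (suc r) zero    = 0
ballot (suc r) (suc h) = ballot (suc r) h + ballot r (2 + h)

-- The ballot number of r ∸ 1, read as 0 at r = 0, so that ballot-suc needs no case split.
ballotPred : ℕ → ℕ → ℕ
ballotPred zero    h = 0
ballotPred (suc r) h = ballot r h

ballot-suc : ∀ r h → ballot r (suc h) ≡ ballot r h + ballotPred r (2 + h)
ballot-suc zero    h = refl
ballot-suc (suc r) h = refl

-- The reflection principle: a ballot number is a difference of two adjacent binomial coefficients,
-- here with the subtracted one moved to the left. At h = 0 the two coefficients agree by symmetry;
-- otherwise the recurrence of `ballot` matches Pascal's rule.
ballot-reflection : ∀ r h →
  ballot (suc r) h + suc (r + r + h) C r ≡ suc (r + r + h) C suc r
ballot-reflection r zero = begin
  suc (r + r + 0) C r                       ≡⟨ nCk≡nC[n∸k] (≤-trans (m≤m+n r (suc r)) (≤-reflexive (size≡ r))) ⟩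
  suc (r + r + 0) C (suc (r + r + 0) ∸ r)   ≡⟨ cong (λ n → suc (r + r + 0) C (n ∸ r)) (sym (size≡ r)) ⟩
  suc (r + r + 0) C (r + suc r ∸ r)         ≡⟨ cong (suc (r + r + 0) C_) (m+n∸m≡n r (suc r)) ⟩
  suc (r + r + 0) C suc r                   ∎
  where
  open ≡-Reasoning
  size≡ : ∀ r → r + suc r ≡ suc (r + r + 0)
  size≡ = solve-∀
ballot-reflection zero (suc h) = begin
  ballot 1 h + 1 + 1          ≡⟨ +-comm (ballot 1 h + 1) 1 ⟩
  1 + (ballot 1 h + 1)        ≡⟨ cong (_+_ 1) (ballot-reflection zero h) ⟩
  1 + suc h C 1               ≡⟨ nCk+nC[k+1]≡[n+1]C[k+1] (suc h) 0 ⟩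
  suc (suc h) C 1             ∎
  where open ≡-Reasoning
ballot-reflection (suc r) (suc h) = begin
  b₁ + b₂ + suc (suc r + suc r + suc h) C suc r   ≡⟨ cong (λ n → b₁ + b₂ + suc n C suc r) (+-suc (suc r + suc r) h) ⟩
  b₁ + b₂ + suc X C suc r                         ≡⟨ cong (_+_ (b₁ + b₂)) (nCk+nC[k+1]≡[n+1]C[k+1] X r) ⟨
  b₁ + b₂ + (X C r + X C suc r)                   ≡⟨ rearrange b₁ b₂ (X C r) (X C suc r) ⟩
  (b₂ + X C r) + (b₁ + X C suc r)
    -- Both instances of the induction hypothesis have the same upper index `X`, since trading a
    -- vertex for two forests preserves 2r + h.
    ≡⟨ cong₂ _+_ (subst (λ n → b₂ + suc n C r ≡ suc n C suc r) (size≡ r h) (ballot-reflection r (2 + h)))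
                 (ballot-reflection (suc r) h) ⟩
  X C suc r + X C suc (suc r)                     ≡⟨ nCk+nC[k+1]≡[n+1]C[k+1] X (suc r) ⟩
  suc X C suc (suc r)                             ≡⟨ cong (λ n → suc n C suc (suc r)) (+-suc (suc r + suc r) h) ⟨
  suc (suc r + suc r + suc h) C suc (suc r)       ∎
  where
  open ≡-Reasoning
  X b₁ b₂ : ℕ
  X  = suc (suc r + suc r + h)
  b₁ = ballot (suc (suc r)) h
  b₂ = ballot (suc r) (2 + h)
  rearrange : ∀ a b c d → a + b + (c + d) ≡ (b + c) + (a + d)
  rearrange = solve-∀
  size≡ : ∀ r h → r + r + (2 + h) ≡ suc r + suc r + h
  size≡ = solve-∀

-- The absorption identity, with the upper index written as k + m to avoid subtraction.
[1+k]*nC[1+k] : ∀ k m → suc k * ((k + m) C suc k) ≡ m * ((k + m) C k)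
[1+k]*nC[1+k] k zero = begin
  suc k * ((k + 0) C suc k)  ≡⟨ cong (suc k *_) (k>n⇒nCk≡0 (s≤s (≤-reflexive (+-identityʳ k)))) ⟩
  suc k * 0                  ≡⟨ *-zeroʳ (suc k) ⟩
  0                          ∎
  where open ≡-Reasoning
[1+k]*nC[1+k] zero (suc m) = begin
  1 * (suc m C 1)  ≡⟨ *-identityˡ _ ⟩
  suc m C 1        ≡⟨ nC1≡n (suc m) ⟩
  suc m            ≡⟨ *-identityʳ (suc m) ⟨
  suc m * 1        ∎
  where open ≡-Reasoning
[1+k]*nC[1+k] (suc k) (suc m) = begin
  (2 + k) * ((suc k + suc m) C (2 + k))           ≡⟨ cong (λ n → (2 + k) * (n C (2 + k))) n≡ ⟩
  (2 + k) * (suc n C (2 + k))                     ≡⟨ cong ((2 + k) *_) (nCk+nC[k+1]≡[n+1]C[k+1] n (suc k)) ⟨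
  (2 + k) * (n C suc k + n C (2 + k))             ≡⟨ *-distribˡ-+ (2 + k) (n C suc k) (n C (2 + k)) ⟩
  (2 + k) * (n C suc k) + (2 + k) * (n C (2 + k)) ≡⟨ cong (_+_ ((2 + k) * (n C suc k))) ([1+k]*nC[1+k] (suc k) m) ⟩
  (2 + k) * (n C suc k) + m * (n C suc k)         ≡⟨ rearrange k m (n C suc k) ⟩
  suc k * (n C suc k) + suc m * (n C suc k)       ≡⟨ cong (_+ suc m * (n C suc k)) absorb ⟩
  suc m * (n C k) + suc m * (n C suc k)           ≡⟨ *-distribˡ-+ (suc m) (n C k) (n C suc k) ⟨
  suc m * (n C k + n C suc k)                     ≡⟨ cong (suc m *_) (nCk+nC[k+1]≡[n+1]C[k+1] n k) ⟩
  suc m * (suc n C suc k)                         ≡⟨ cong (λ n → suc m * (n C suc k)) n≡ ⟨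
  suc m * ((suc k + suc m) C suc k)               ∎
  where
  open ≡-Reasoning
  n : ℕ
  n = suc k + m
  n≡ : suc k + suc m ≡ suc n
  n≡ = +-suc (suc k) m
  absorb : suc k * (n C suc k) ≡ suc m * (n C k)
  absorb = subst (λ n → suc k * (n C suc k) ≡ suc m * (n C k)) (+-suc k m) ([1+k]*nC[1+k] k (suc m))
  rearrange : ∀ k m c → (2 + k) * c + m * c ≡ suc k * c + suc m * c
  rearrange = solve-∀

-- For n = r + 1, reflection at h = 1 gives (2n C n) - (2n C r), and absorption turns (n + 1)(2n C
-- r) into n (2n C n). The subtracted term is added to both sides and cancelled.
ballot-1*suc : ∀ n → ballot n 1 * suc n ≡ (2 * n) C n
ballot-1*suc zero    = refl
ballot-1*suc (suc r) = +-cancelʳ-≡ ((2 + r) * (X C r)) _ _ (begin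
  b * (2 + r) + (2 + r) * (X C r)        ≡⟨ factor b r (X C r) ⟩
  (2 + r) * (b + X C r)                  ≡⟨ cong ((2 + r) *_) (subst (λ n → b + n C r ≡ n C suc r) (size≡₁ r)
                                                                   (ballot-reflection r 1)) ⟩
  (2 + r) * (X C suc r)                  ≡⟨⟩
  X C suc r + suc r * (X C suc r)        ≡⟨ cong (_+_ (X C suc r)) (subst (λ n → suc r * (n C suc r) ≡ (2 + r) * (n C r))
                                                                         (size≡₂ r) ([1+k]*nC[1+k] r (2 + r))) ⟩
  X C suc r + (2 + r) * (X C r)          ∎)
  where
  open ≡-Reasoning
  X b : ℕ
  X = 2 * suc r
  b = ballot (suc r) 1
  factor : ∀ b r c → b * (2 + r) + (2 + r) * c ≡ (2 + r) * (b + c)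
  factor = solve-∀
  size≡₁ : ∀ r → suc (r + r + 1) ≡ 2 * suc r
  size≡₁ = solve-∀
  size≡₂ : ∀ r → r + (2 + r) ≡ 2 * suc r
  size≡₂ = solve-∀

ballot-catalan : ∀ n → ballot n 1 ≡ catalan n
ballot-catalan n = trans (sym (m*n/n≡m (ballot n 1) (suc n))) (cong (_/ suc n) (ballot-1*suc n))

-- Coefficients of (1 - x)ᵏ xᵉ

coeff-0∷[] : ∀ c → coeff (+ 0 ∷ []) c ≡ + 0
coeff-0∷[] zero    = refl
coeff-0∷[] (suc c) = refl

coeff-+ₚ : ∀ p q c → coeff (p +ₚ q) c ≡ coeff p c ℤ.+ coeff q c
coeff-+ₚ []      q       c       = sym (ℤ.+-identityˡ _)
coeff-+ₚ (a ∷ p) []      c       = sym (ℤ.+-identityʳ _)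
coeff-+ₚ (a ∷ p) (b ∷ q) zero    = refl
coeff-+ₚ (a ∷ p) (b ∷ q) (suc c) = coeff-+ₚ p q c

coeff-·ₚ : ∀ a p c → coeff (a ·ₚ p) c ≡ a ℤ.* coeff p c
coeff-·ₚ a []      c       = sym (ℤ.*-zeroʳ a)
coeff-·ₚ a (b ∷ p) zero    = refl
coeff-·ₚ a (b ∷ p) (suc c) = coeff-·ₚ a p c

coeff-∷*ₚ : ∀ a p q c → coeff ((a ∷ p) *ₚ q) c ≡ a ℤ.* coeff q c ℤ.+ coeff (+ 0 ∷ p *ₚ q) c
coeff-∷*ₚ a p q c =
  trans (coeff-+ₚ (a ·ₚ q) _ c) (cong (ℤ._+ coeff (+ 0 ∷ p *ₚ q) c) (coeff-·ₚ a q c))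

infix 4 _≈ₚ_

-- Lists that differ by trailing zeros represent the same polynomial, so identities are stated
-- coefficientwise.
_≈ₚ_ : Poly → Poly → Set
p ≈ₚ q = ∀ c → coeff p c ≡ coeff q c

∷-congₚ : ∀ a {p q} → p ≈ₚ q → a ∷ p ≈ₚ a ∷ q
∷-congₚ a p≈q zero    = refl
∷-congₚ a p≈q (suc c) = p≈q c

*ₚ-congˡ : ∀ p {q r} → q ≈ₚ r → p *ₚ q ≈ₚ p *ₚ r
*ₚ-congˡ []      q≈r c = refl
*ₚ-congˡ (a ∷ p) {q} {r} q≈r c = trans (coeff-∷*ₚ a p q c) (trans
  (cong₂ ℤ._+_ (cong (a ℤ.*_) (q≈r c)) (∷-congₚ (+ 0) (*ₚ-congˡ p q≈r) c))
  (sym (coeff-∷*ₚ a p r c)))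

*ₚ-0∷ : ∀ p q → p *ₚ (+ 0 ∷ q) ≈ₚ + 0 ∷ p *ₚ q
*ₚ-0∷ []      q zero    = refl
*ₚ-0∷ []      q (suc c) = refl
*ₚ-0∷ (a ∷ p) q zero    = trans (coeff-∷*ₚ a p (+ 0 ∷ q) 0) (cong (ℤ._+ + 0) (ℤ.*-zeroʳ a))
*ₚ-0∷ (a ∷ p) q (suc c) = trans (coeff-∷*ₚ a p (+ 0 ∷ q) (suc c)) (trans
  (cong (ℤ._+_ (a ℤ.* coeff q c)) (*ₚ-0∷ p q c))
  (sym (coeff-∷*ₚ a p q c)))

Xₚ-*ₚ : ∀ q → Xₚ *ₚ q ≈ₚ + 0 ∷ q
Xₚ-*ₚ q zero    = trans (coeff-∷*ₚ (+ 0) (+ 1 ∷ []) q 0) (trans (ℤ.+-identityʳ _) (ℤ.*-zeroˡ (coeff q 0)))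
Xₚ-*ₚ q (suc c) = begin
  coeff (Xₚ *ₚ q) (suc c)                              ≡⟨ coeff-∷*ₚ (+ 0) (+ 1 ∷ []) q (suc c) ⟩
  + 0 ℤ.* coeff q (suc c) ℤ.+ coeff ((+ 1 ∷ []) *ₚ q) c
    ≡⟨ cong₂ ℤ._+_ (ℤ.*-zeroˡ (coeff q (suc c))) (trans (coeff-∷*ₚ (+ 1) [] q c) (cong (ℤ._+_ (+ 1 ℤ.* coeff q c)) (coeff-0∷[] c))) ⟩
  + 0 ℤ.+ (+ 1 ℤ.* coeff q c ℤ.+ + 0)                  ≡⟨ simplify (coeff q c) ⟩
  coeff q c                                            ∎
  where
  open ≡-Reasoning
  simplify : ∀ a → + 0 ℤ.+ (+ 1 ℤ.* a ℤ.+ + 0) ≡ a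
  simplify = ℤ-Solver.solve-∀

*ₚ-distribʳ-+ₚ : ∀ p q r → (p +ₚ q) *ₚ r ≈ₚ (p *ₚ r) +ₚ (q *ₚ r)
*ₚ-distribʳ-+ₚ []      q       r c = refl
*ₚ-distribʳ-+ₚ (a ∷ p) []      r c = sym (trans (coeff-+ₚ ((a ∷ p) *ₚ r) [] c) (ℤ.+-identityʳ _))
*ₚ-distribʳ-+ₚ (a ∷ p) (b ∷ q) r c = begin
  coeff ((a ℤ.+ b ∷ p +ₚ q) *ₚ r) c
    ≡⟨ coeff-∷*ₚ (a ℤ.+ b) (p +ₚ q) r c ⟩
  (a ℤ.+ b) ℤ.* coeff r c ℤ.+ coeff (+ 0 ∷ (p +ₚ q) *ₚ r) c
    ≡⟨ cong (ℤ._+_ ((a ℤ.+ b) ℤ.* coeff r c)) (trans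
         (∷-congₚ (+ 0) (*ₚ-distribʳ-+ₚ p q r) c) (coeff-+ₚ (+ 0 ∷ p *ₚ r) (+ 0 ∷ q *ₚ r) c)) ⟩
  (a ℤ.+ b) ℤ.* coeff r c ℤ.+ (coeff (+ 0 ∷ p *ₚ r) c ℤ.+ coeff (+ 0 ∷ q *ₚ r) c)
    ≡⟨ rearrange a b (coeff r c) _ _ ⟩
  (a ℤ.* coeff r c ℤ.+ coeff (+ 0 ∷ p *ₚ r) c) ℤ.+ (b ℤ.* coeff r c ℤ.+ coeff (+ 0 ∷ q *ₚ r) c)
    ≡⟨ cong₂ ℤ._+_ (coeff-∷*ₚ a p r c) (coeff-∷*ₚ b q r c) ⟨
  coeff ((a ∷ p) *ₚ r) c ℤ.+ coeff ((b ∷ q) *ₚ r) c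
    ≡⟨ coeff-+ₚ ((a ∷ p) *ₚ r) ((b ∷ q) *ₚ r) c ⟨
  coeff ((a ∷ p) *ₚ r +ₚ (b ∷ q) *ₚ r) c ∎
  where
  open ≡-Reasoning
  rearrange : ∀ a b r u v → (a ℤ.+ b) ℤ.* r ℤ.+ (u ℤ.+ v) ≡ (a ℤ.* r ℤ.+ u) ℤ.+ (b ℤ.* r ℤ.+ v)
  rearrange = ℤ-Solver.solve-∀

·ₚ-*ₚ : ∀ a p q c → coeff ((a ·ₚ p) *ₚ q) c ≡ a ℤ.* coeff (p *ₚ q) c
·ₚ-*ₚ a []      q c = sym (ℤ.*-zeroʳ a)
·ₚ-*ₚ a (b ∷ p) q c = begin
  coeff ((a ℤ.* b ∷ a ·ₚ p) *ₚ q) c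
    ≡⟨ coeff-∷*ₚ (a ℤ.* b) (a ·ₚ p) q c ⟩
  a ℤ.* b ℤ.* coeff q c ℤ.+ coeff (+ 0 ∷ (a ·ₚ p) *ₚ q) c
    ≡⟨ cong₂ ℤ._+_ (ℤ.*-assoc a b (coeff q c)) (shift c) ⟩
  a ℤ.* (b ℤ.* coeff q c) ℤ.+ a ℤ.* coeff (+ 0 ∷ p *ₚ q) c
    ≡⟨ ℤ.*-distribˡ-+ a (b ℤ.* coeff q c) (coeff (+ 0 ∷ p *ₚ q) c) ⟨
  a ℤ.* (b ℤ.* coeff q c ℤ.+ coeff (+ 0 ∷ p *ₚ q) c)
    ≡⟨ cong (a ℤ.*_) (coeff-∷*ₚ b p q c) ⟨
  a ℤ.* coeff ((b ∷ p) *ₚ q) c ∎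
  where
  open ≡-Reasoning
  shift : ∀ c → coeff (+ 0 ∷ (a ·ₚ p) *ₚ q) c ≡ a ℤ.* coeff (+ 0 ∷ p *ₚ q) c
  shift zero    = sym (ℤ.*-zeroʳ a)
  shift (suc c) = ·ₚ-*ₚ a p q c

mixedPower : ℕ → ℕ → Poly
mixedPower k e = (oneMinusX ^ₚ k) *ₚ (Xₚ ^ₚ e)

oneMinusX-*ₚ-*ₚ : ∀ p q c →
  coeff ((oneMinusX *ₚ p) *ₚ q) c ≡ coeff (p *ₚ q) c ℤ.- coeff (+ 0 ∷ p *ₚ q) c
oneMinusX-*ₚ-*ₚ p q c = begin
  coeff ((oneMinusX *ₚ p) *ₚ q) c
    ≡⟨ *ₚ-distribʳ-+ₚ (+ 1 ·ₚ p) (+ 0 ∷ p′) q c ⟩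
  coeff ((+ 1 ·ₚ p) *ₚ q +ₚ (+ 0 ∷ p′) *ₚ q) c
    ≡⟨ coeff-+ₚ ((+ 1 ·ₚ p) *ₚ q) _ c ⟩
  coeff ((+ 1 ·ₚ p) *ₚ q) c ℤ.+ coeff ((+ 0 ∷ p′) *ₚ q) c
    ≡⟨ cong₂ ℤ._+_ (·ₚ-*ₚ (+ 1) p q c) (coeff-∷*ₚ (+ 0) p′ q c) ⟩
  + 1 ℤ.* coeff (p *ₚ q) c ℤ.+ (+ 0 ℤ.* coeff q c ℤ.+ coeff (+ 0 ∷ p′ *ₚ q) c)
    ≡⟨ cong (λ z → + 1 ℤ.* coeff (p *ₚ q) c ℤ.+ (+ 0 ℤ.* coeff q c ℤ.+ z)) (negate c) ⟩
  + 1 ℤ.* coeff (p *ₚ q) c ℤ.+ (+ 0 ℤ.* coeff q c ℤ.- coeff (+ 0 ∷ p *ₚ q) c)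
    ≡⟨ simplify (coeff (p *ₚ q) c) (coeff q c) _ ⟩
  coeff (p *ₚ q) c ℤ.- coeff (+ 0 ∷ p *ₚ q) c ∎
  where
  open ≡-Reasoning
  -- The tail of `oneMinusX` times p, which is -p up to trailing zeros; `negate` evaluates it.
  p′ : Poly
  p′ = (ℤ.- + 1 ∷ []) *ₚ p
  simplify : ∀ a b c → + 1 ℤ.* a ℤ.+ (+ 0 ℤ.* b ℤ.- c) ≡ a ℤ.- c
  simplify = ℤ-Solver.solve-∀
  zeros : ∀ c → coeff ((+ 0 ∷ []) *ₚ q) c ≡ + 0
  zeros c = trans (coeff-∷*ₚ (+ 0) [] q c) (cong₂ ℤ._+_ (ℤ.*-zeroˡ (coeff q c)) (coeff-0∷[] c))
  negate : ∀ c → coeff (+ 0 ∷ p′ *ₚ q) c ≡ ℤ.- coeff (+ 0 ∷ p *ₚ q) c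
  negate zero    = refl
  negate (suc c) = begin
    coeff (p′ *ₚ q) c
      ≡⟨ *ₚ-distribʳ-+ₚ ((ℤ.- + 1) ·ₚ p) (+ 0 ∷ []) q c ⟩
    coeff (((ℤ.- + 1) ·ₚ p) *ₚ q +ₚ (+ 0 ∷ []) *ₚ q) c
      ≡⟨ coeff-+ₚ (((ℤ.- + 1) ·ₚ p) *ₚ q) _ c ⟩
    coeff (((ℤ.- + 1) ·ₚ p) *ₚ q) c ℤ.+ coeff ((+ 0 ∷ []) *ₚ q) c
      ≡⟨ cong₂ ℤ._+_ (·ₚ-*ₚ (ℤ.- + 1) p q c) (zeros c) ⟩
    ℤ.- + 1 ℤ.* coeff (p *ₚ q) c ℤ.+ + 0
      ≡⟨ trans (ℤ.+-identityʳ _) (ℤ.-1*i≡-i _) ⟩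
    ℤ.- coeff (p *ₚ q) c ∎

-- This is x + (1 - x) = 1, multiplied by (1 - x)ᵏ xᵉ.
mixedPower-suc : ∀ k e c →
  coeff (mixedPower k (suc e)) c ℤ.+ coeff (mixedPower (suc k) e) c ≡ coeff (mixedPower k e) c
mixedPower-suc k e c = begin
  coeff (mixedPower k (suc e)) c ℤ.+ coeff (mixedPower (suc k) e) c
    ≡⟨ cong₂ ℤ._+_
         (trans (*ₚ-congˡ (oneMinusX ^ₚ k) (Xₚ-*ₚ (Xₚ ^ₚ e)) c) (*ₚ-0∷ (oneMinusX ^ₚ k) (Xₚ ^ₚ e) c))
         (oneMinusX-*ₚ-*ₚ (oneMinusX ^ₚ k) (Xₚ ^ₚ e) c) ⟩
  coeff (+ 0 ∷ mixedPower k e) c ℤ.+ (coeff (mixedPower k e) c ℤ.- coeff (+ 0 ∷ mixedPower k e) c)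
    ≡⟨ cancel (coeff (+ 0 ∷ mixedPower k e) c) _ ⟩
  coeff (mixedPower k e) c ∎
  where
  open ≡-Reasoning
  cancel : ∀ a b → a ℤ.+ (b ℤ.- a) ≡ b
  cancel = ℤ-Solver.solve-∀

bit : Bool → ℕ
bit b = if b then 1 else 0

δ : ℕ → ℕ → ℕ
δ a b = bit (does (a ≟ b))

coeff-Xₚ^ : ∀ e c → coeff (Xₚ ^ₚ e) c ≡ + δ e c
coeff-Xₚ^ zero    zero    = refl
coeff-Xₚ^ zero    (suc c) = refl
coeff-Xₚ^ (suc e) zero    = Xₚ-*ₚ (Xₚ ^ₚ e) 0
coeff-Xₚ^ (suc e) (suc c) =
  trans (Xₚ-*ₚ (Xₚ ^ₚ e) (suc c)) (coeff-Xₚ^ e c)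

coeff-mixedPower-0 : ∀ e c → coeff (mixedPower 0 e) c ≡ + δ e c
coeff-mixedPower-0 e c = begin
  coeff (mixedPower 0 e) c                              ≡⟨ coeff-∷*ₚ (+ 1) [] (Xₚ ^ₚ e) c ⟩
  + 1 ℤ.* coeff (Xₚ ^ₚ e) c ℤ.+ coeff (+ 0 ∷ []) c      ≡⟨ cong₂ ℤ._+_ (ℤ.*-identityˡ (coeff (Xₚ ^ₚ e) c)) (coeff-0∷[] c) ⟩
  coeff (Xₚ ^ₚ e) c ℤ.+ + 0                             ≡⟨ ℤ.+-identityʳ _ ⟩
  coeff (Xₚ ^ₚ e) c                                     ≡⟨ coeff-Xₚ^ e c ⟩
  + δ e c                                               ∎
  where
  open ≡-Reasoning

-- Each of the `w` Pascal steps merges neighbours on an antidiagonal and lowers the second index by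
-- one. The family `G` is arbitrary so that the induction can pass to `G ∘ suc`.
transform-telescope : (G : ℕ → ℕ → ℤ) → (∀ s e → G s (suc e) ℤ.+ G (suc s) e ≡ G s e) →
  ∀ w {d} → w ≤ d → ℤ-Sum.transform w (λ s → G s (d ∸ s)) ≡ G 0 (d ∸ w)
transform-telescope G rec zero    w≤d = refl
transform-telescope G rec (suc w) {suc d} (s≤s w≤d) = begin
  ℤ-Sum.transform w (λ s → G s (suc d ∸ s)) ℤ.+ ℤ-Sum.transform w (λ s → G (suc s) (d ∸ s))
    ≡⟨ cong₂ ℤ._+_ (transform-telescope G rec w (m≤n⇒m≤1+n w≤d))
                   (transform-telescope (G ∘ suc) (rec ∘ suc) w w≤d) ⟩
  G 0 (suc d ∸ w) ℤ.+ G 1 (d ∸ w)   ≡⟨ cong (λ e → G 0 e ℤ.+ G 1 (d ∸ w)) (+-∸-assoc 1 w≤d) ⟩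
  G 0 (suc (d ∸ w)) ℤ.+ G 1 (d ∸ w) ≡⟨ rec 0 (d ∸ w) ⟩
  G 0 (d ∸ w)                       ∎
  where open ≡-Reasoning

-- The expansion of xᵈ⁻ʷ ((1 - x) + x)ʷ = xᵈ⁻ʷ by the binomial theorem.
∑-binomial-mixedPower : ∀ {w n d} → w < n → w ≤ d → ∀ c →
  ℤ-Sum.∑< n (λ k → + (w C k) ℤ.* coeff (mixedPower k (d ∸ k)) c) ≡ + δ (d ∸ w) c
∑-binomial-mixedPower {w} {n} {d} w<n w≤d c = begin
  ℤ-Sum.∑< n (λ k → + (w C k) ℤ.* coeff (mixedPower k (d ∸ k)) c)
    ≡⟨ ℤ-Sum.∑<-cong n (λ k _ → ℤ-×≡* (w C k) _) ⟨
  _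
    ≡⟨ ℤ-Sum.∑<-binomial w (λ k → coeff (mixedPower k (d ∸ k)) c) w<n ⟩
  ℤ-Sum.transform w (λ k → coeff (mixedPower k (d ∸ k)) c)
    ≡⟨ transform-telescope (λ k e → coeff (mixedPower k e) c) (λ k e → mixedPower-suc k e c) w w≤d ⟩
  coeff (mixedPower 0 (d ∸ w)) c
    ≡⟨ coeff-mixedPower-0 (d ∸ w) c ⟩
  + δ (d ∸ w) c ∎
  where open ≡-Reasoning

coeff-sumₚ-upTo : (t : ℕ → Poly) → ∀ n c →
  coeff (sumₚ (map t (upTo n))) c ≡ ℤ-Sum.∑< n (λ k → coeff (t k) c)
coeff-sumₚ-upTo t n c = trans (cong (λ ps → coeff (sumₚ ps) c) (map-upTo t n)) (go n t)
  where
  go : ∀ n t → coeff (sumₚ (applyUpTo t n)) c ≡ ℤ-Sum.∑< n (λ k → coeff (t k) c)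
  go zero    t = refl
  go (suc n) t = trans (coeff-+ₚ (t 0) _ c) (cong (ℤ._+_ (coeff (t 0) c)) (go n (t ∘ suc)))

coeff-f : ∀ d i j c →
  coeff (f d i j) c ≡
  ℤ-Sum.∑< d (λ k → + (catalan (d ∸ 1 ∸ k) * innerSum d i j k) ℤ.* coeff (mixedPower k (d ∸ k)) c)
coeff-f d i j c =
  trans (coeff-sumₚ-upTo _ d c) (ℤ-Sum.∑<-cong d λ k _ → coeff-·ₚ (+ (catalan (d ∸ 1 ∸ k) * innerSum d i j k)) (mixedPower k (d ∸ k)) c)

-- Sums over sequences of forests

Forests : ℕ → Set
Forests h = Vec (List PlaneTree) h

-- Postorder reads a sequence of forests from its last entry to its first one.
total : ∀ {h} → Forests h → ℕ
total []      = 0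
total (F ∷ x) = total x + sizes F

-- Adds a new last vertex in postorder: the root of the last tree of the first forest.
graft : ∀ {h} → Forests (2 + h) → Forests (1 + h)
graft (F ∷ G ∷ x) = (G ∷ʳ node F) ∷ x

sizes-∷ʳ : ∀ F t → sizes (F ∷ʳ t) ≡ sizes F + size t
sizes-∷ʳ []      t = +-identityʳ (size t)
sizes-∷ʳ (u ∷ F) t = trans (cong (_+_ (size u)) (sizes-∷ʳ F t)) (sym (+-assoc (size u) (sizes F) (size t)))

total-graft : ∀ {h} (x : Forests (2 + h)) → total (graft x) ≡ suc (total x)
total-graft (F ∷ G ∷ x) = begin
  total x + sizes (G ∷ʳ node F)        ≡⟨ cong (_+_ (total x)) (sizes-∷ʳ G (node F)) ⟩
  total x + (sizes G + suc (sizes F))  ≡⟨ +-assoc (total x) (sizes G) (suc (sizes F)) ⟨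
  total x + sizes G + suc (sizes F)    ≡⟨ +-suc (total x + sizes G) (sizes F) ⟩
  suc (total x + sizes G + sizes F)    ∎
  where open ≡-Reasoning

-- The sum of φ over the sequences of h forests with n vertices.
∑F : ∀ (n h : ℕ) → (Forests h → ℕ) → ℕ
∑F zero    zero    φ = φ []
∑F (suc n) zero    φ = 0
∑F zero    (suc h) φ = ∑F zero h (φ ∘ ([] ∷_))
∑F (suc n) (suc h) φ = ∑F (suc n) h (φ ∘ ([] ∷_)) + ∑F n (2 + h) (φ ∘ graft)

-- The pointwise equation may use the total, because that number fixes the label of a grafted root
-- and hence its mark.
∑F-cong : ∀ n h {φ ψ : Forests h → ℕ} → (∀ x → total x ≡ n → φ x ≡ ψ x) → ∑F n h φ ≡ ∑F n h ψ
∑F-cong zero    zero    eq = eq [] refl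
∑F-cong (suc n) zero    eq = refl
∑F-cong zero    (suc h) eq =
  ∑F-cong zero h λ x x≡ → eq ([] ∷ x) (trans (+-identityʳ _) x≡)
∑F-cong (suc n) (suc h) eq = cong₂ _+_
  (∑F-cong (suc n) h λ x x≡ → eq ([] ∷ x) (trans (+-identityʳ _) x≡))
  (∑F-cong n (2 + h) λ x x≡ → eq (graft x) (trans (total-graft x) (cong suc x≡)))

∑F-+ : ∀ n h (φ ψ : Forests h → ℕ) → ∑F n h (λ x → φ x + ψ x) ≡ ∑F n h φ + ∑F n h ψ
∑F-+ zero    zero    φ ψ = refl
∑F-+ (suc n) zero    φ ψ = refl
∑F-+ zero    (suc h) φ ψ = ∑F-+ zero h _ _
∑F-+ (suc n) (suc h) φ ψ =
  trans (cong₂ _+_ (∑F-+ (suc n) h (φ ∘ ([] ∷_)) (ψ ∘ ([] ∷_)))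
                   (∑F-+ n (2 + h) (φ ∘ graft) (ψ ∘ graft)))
        (interchange (∑F (suc n) h (φ ∘ ([] ∷_))) (∑F (suc n) h (ψ ∘ ([] ∷_))) _ _)

∑F-0 : ∀ n h → ∑F n h (λ _ → 0) ≡ 0
∑F-0 zero    zero    = refl
∑F-0 (suc n) zero    = refl
∑F-0 zero    (suc h) = ∑F-0 zero h
∑F-0 (suc n) (suc h) = cong₂ _+_ (∑F-0 (suc n) h) (∑F-0 n (2 + h))

-- `∑F` and `ballot` obey the same recurrence.
∑F-1 : ∀ n h → ∑F n h (λ _ → 1) ≡ ballot n h
∑F-1 zero    zero    = refl
∑F-1 (suc n) zero    = refl
∑F-1 zero    (suc h) = ∑F-1 zero h
∑F-1 (suc n) (suc h) = cong₂ _+_ (∑F-1 (suc n) h) (∑F-1 n (2 + h))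

emptyAt : ∀ {h} → Fin h → Forests h → ℕ
emptyAt p x = bit (null (lookup x p))

null-∷ʳ : ∀ F (t : PlaneTree) → null (F ∷ʳ t) ≡ false
null-∷ʳ []      t = refl
null-∷ʳ (_ ∷ _) t = refl

-- A forest forced to be empty can be deleted from the sequence. At position zero every grafted
-- sequence drops out, since its first forest is nonempty.
∑F-emptyAt : ∀ n {h} (p : Fin (suc h)) (φ : Forests (suc h) → ℕ) →
  ∑F n (suc h) (λ x → emptyAt p x * φ x) ≡ ∑F n h (λ x → φ (insertAt x p []))
∑F-emptyAt zero {h} zero φ = ∑F-cong zero h λ x _ → *-identityˡ _
∑F-emptyAt (suc n) {h} zero φ = begin
  ∑F (suc n) h (λ x → 1 * φ ([] ∷ x)) + ∑F n (2 + h) (λ x → emptyAt zero (graft x) * φ (graft x))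
    ≡⟨ cong₂ _+_ (∑F-cong (suc n) h λ x _ → *-identityˡ _)
                 (∑F-cong n (2 + h) λ { (F ∷ G ∷ x) _ →
                    cong (λ b → bit b * φ (graft (F ∷ G ∷ x))) (null-∷ʳ G (node F)) }) ⟩
  ∑F (suc n) h (λ x → φ ([] ∷ x)) + ∑F n (2 + h) (λ _ → 0)
    ≡⟨ cong (_+_ (∑F (suc n) h (λ x → φ ([] ∷ x)))) (∑F-0 n (2 + h)) ⟩
  ∑F (suc n) h (λ x → φ ([] ∷ x)) + 0
    ≡⟨ +-identityʳ _ ⟩
  ∑F (suc n) h (λ x → φ ([] ∷ x)) ∎
  where open ≡-Reasoning
∑F-emptyAt zero    {suc h} (suc p) φ = ∑F-emptyAt zero p (φ ∘ ([] ∷_))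
∑F-emptyAt (suc n) {suc h} (suc p) φ = cong₂ _+_
  (∑F-emptyAt (suc n) p (φ ∘ ([] ∷_)))
  (begin
    ∑F n (3 + h) (λ x → emptyAt (suc p) (graft x) * φ (graft x))
      ≡⟨ ∑F-cong n (3 + h) (λ { (F ∷ G ∷ x) _ → refl }) ⟩
    ∑F n (3 + h) (λ x → emptyAt (suc (suc p)) x * φ (graft x))
      ≡⟨ ∑F-emptyAt n (suc (suc p)) (φ ∘ graft) ⟩
    ∑F n (2 + h) (λ x → φ (graft (insertAt x (suc (suc p)) [])))
      ≡⟨ ∑F-cong n (2 + h) (λ { (F ∷ G ∷ x) _ → refl }) ⟩
    ∑F n (2 + h) (λ x → φ (insertAt (graft x) (suc p) [])) ∎)
  where open ≡-Reasoning

-- Binomial moments of the number of marked vertices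


bit-≤1 : ∀ b → bit b ≤ 1
bit-≤1 true  = s≤s z≤n
bit-≤1 false = z≤n

module Moments (d i j : ℕ) where

  marked-≤1 : ∀ leaf leftmost l → marked d i j leaf leftmost l ≤ 1
  marked-≤1 true  true  l = ≤-refl
  marked-≤1 true  false l = bit-≤1 (does (l ≤? i) ∨ does (d ∸ j ≤? l))
  marked-≤1 false true  l = bit-≤1 (does (d ∸ j ≤? l))
  marked-≤1 false false l = z≤n

  -- Types [0] and [1] together are all the leaves, and type [2] does not count at these labels.
  marked-low : ∀ leaf leftmost {l} → l ≤ i → l < d ∸ j → marked d i j leaf leftmost l ≡ bit leaf
  marked-low true  true  l≤i l<d-j = refl
  marked-low true  false {l} l≤i l<d-j rewrite dec-true (l ≤? i) l≤i = refl
  marked-low false true  {l} l≤i l<d-j rewrite dec-false (d ∸ j ≤? l) (<⇒≱ l<d-j) = refl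
  marked-low false false l≤i l<d-j = refl

  -- Only type [0] counts here, hence the product of the two indicators.
  marked-mid : ∀ leaf leftmost {l} → i < l → l < d ∸ j →
    marked d i j leaf leftmost l ≡ bit leaf * bit leftmost
  marked-mid true  true  i<l l<d-j = refl
  marked-mid true  false {l} i<l l<d-j
    rewrite dec-false (l ≤? i) (<⇒≱ i<l) | dec-false (d ∸ j ≤? l) (<⇒≱ l<d-j) = refl
  marked-mid false true  {l} i<l l<d-j rewrite dec-false (d ∸ j ≤? l) (<⇒≱ l<d-j) = refl
  marked-mid false false i<l l<d-j = refl

  -- Inclusion–exclusion, with both sides moved so that no subtraction occurs.
  marked-high : ∀ leaf leftmost {l} → d ∸ j ≤ l →
    marked d i j leaf leftmost l + bit leaf * bit leftmost ≡ bit leaf + bit leftmost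
  marked-high true  true  d-j≤l = refl
  marked-high true  false {l} d-j≤l with does (l ≤? i)
  ... | true  = refl
  ... | false rewrite dec-true (d ∸ j ≤? l) d-j≤l = refl
  marked-high false true  {l} d-j≤l rewrite dec-true (d ∸ j ≤? l) d-j≤l = refl
  marked-high false false d-j≤l = refl

  mutual
    countSub-≤ : ∀ off leftmost t → countSub d i j off leftmost t ≤ size t
    countSub-≤ off leftmost (node F) =
      +-mono-≤ (marked-≤1 (isLeaf (node F)) leftmost _) (countChildren-≤ off true F)

    countChildren-≤ : ∀ off leftmost F → countChildren d i j off leftmost F ≤ sizes F
    countChildren-≤ off leftmost []      = z≤n
    countChildren-≤ off leftmost (t ∷ F) =
      +-mono-≤ (countSub-≤ off leftmost t) (countChildren-≤ (off + size t) false F)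

  -- `countChildren` works from the left but `graft` appends on the right; the appended tree
  -- inherits the leftmost flag only when nothing precedes it.
  countChildren-∷ʳ : ∀ off leftmost F t →
    countChildren d i j off leftmost (F ∷ʳ t) ≡
    countChildren d i j off leftmost F +
      countSub d i j (off + sizes F) (if null F then leftmost else false) t
  countChildren-∷ʳ off leftmost [] t =
    trans (+-identityʳ _) (cong (λ o → countSub d i j o leftmost t) (sym (+-identityʳ off)))
  countChildren-∷ʳ off leftmost (u ∷ F) t = begin
    cu + countChildren d i j (off + size u) false (F ∷ʳ t)
      ≡⟨ cong (_+_ cu) (countChildren-∷ʳ (off + size u) false F t) ⟩
    cu + (cF + countSub d i j (off + size u + sizes F) (if null F then false else false) t)
      ≡⟨ +-assoc cu cF _ ⟨
    cu + cF + countSub d i j (off + size u + sizes F) (if null F then false else false) t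
      ≡⟨ cong₂ (λ o b → cu + cF + countSub d i j o b t) (+-assoc off (size u) (sizes F)) (constant (null F)) ⟩
    cu + cF + countSub d i j (off + (size u + sizes F)) false t ∎
    where
    open ≡-Reasoning
    cu cF : ℕ
    cu = countSub d i j off leftmost u
    cF = countChildren d i j (off + size u) false F
    constant : ∀ b → (if b then false else false) ≡ false
    constant true  = refl
    constant false = refl

  -- Each forest is treated as the children of a parent of its own, so its first root is leftmost.
  -- The offset is `total x` because the later entries come first in postorder.
  weight : ∀ {h} → Forests h → ℕ
  weight []      = 0
  weight (F ∷ x) = countChildren d i j (total x) true F + weight x

  weight-≤ : ∀ {h} (x : Forests h) → weight x ≤ total x
  weight-≤ []      = z≤n
  weight-≤ (F ∷ x) = ≤-trans (+-mono-≤ (countChildren-≤ (total x) true F) (weight-≤ x))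
                             (≤-reflexive (+-comm (sizes F) (total x)))

  -- The mark of the root that `graft` adds: it is a leaf when `F` is empty and leftmost when `G` is
  -- empty. Marks thus become emptiness conditions on the smaller sequence.
  rootMark : ∀ {h} → Forests (2 + h) → ℕ
  rootMark (F ∷ G ∷ x) = marked d i j (null F) (null G) (suc (total (F ∷ G ∷ x)))

  rootMark-≤1 : ∀ {h} (x : Forests (2 + h)) → rootMark x ≤ 1
  rootMark-≤1 (F ∷ G ∷ x) = marked-≤1 (null F) (null G) _

  -- The new root is last in postorder, so grafting changes no other label; the trees of `F` become
  -- its children and keep their leftmost flags.
  weight-graft : ∀ {h} (x : Forests (2 + h)) → weight (graft x) ≡ rootMark x + weight x
  weight-graft (F ∷ G ∷ x) = begin
    countChildren d i j (total x) true (G ∷ʳ node F) + weight x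
      ≡⟨ cong (_+ weight x) (countChildren-∷ʳ (total x) true G (node F)) ⟩
    cG + (marked d i j (isLeaf (node F)) (if null G then true else false) (t + suc (sizes F)) + cF) + weight x
      ≡⟨ cong (λ m → cG + (m + cF) + weight x) mark ⟩
    cG + (marked d i j (null F) (null G) (suc (t + sizes F)) + cF) + weight x
      ≡⟨ rearrange cG _ cF (weight x) ⟩
    marked d i j (null F) (null G) (suc (t + sizes F)) + (cF + (cG + weight x)) ∎
    where
    open ≡-Reasoning
    t cF cG : ℕ
    t  = total (G ∷ x)
    cF = countChildren d i j t true F
    cG = countChildren d i j (total x) true G
    isLeaf≡null : ∀ F → isLeaf (node F) ≡ null F
    isLeaf≡null []      = refl
    isLeaf≡null (_ ∷ _) = refl
    if-η : ∀ b → (if b then true else false) ≡ b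
    if-η true  = refl
    if-η false = refl
    mark : marked d i j (isLeaf (node F)) (if null G then true else false) (t + suc (sizes F)) ≡
           marked d i j (null F) (null G) (suc (t + sizes F))
    mark rewrite isLeaf≡null F | if-η (null G) | +-suc t (sizes F) = refl
    rearrange : ∀ a m b w → a + (m + b) + w ≡ m + (b + (a + w))
    rearrange = solve-∀

  moment : ℕ → ℕ → ℕ → ℕ
  moment k n h = ∑F n h (λ x → weight x C k)

  moment-vanish : ∀ {k n} h → n < k → moment k n h ≡ 0
  moment-vanish {k} {n} h n<k = trans
    (∑F-cong n h λ x x≡n → k>n⇒nCk≡0 (≤-<-trans (≤-trans (weight-≤ x) (≤-reflexive x≡n)) n<k))
    (∑F-0 n h)

  moment-0 : ∀ n h → moment 0 n h ≡ ballot n h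
  moment-0 = ∑F-1

  rootMoment : ℕ → ℕ → ℕ → ℕ
  rootMoment k n h = ∑F n (2 + h) (λ x → rootMark x * (weight x C k))

  -- Either the first forest is empty, or its last root is removed. In the second case the root
  -- contributes 0 or 1 to the weight, and Pascal's rule separates that contribution.
  moment-suc : ∀ k n h →
    moment (suc k) (suc n) (suc h) ≡
    moment (suc k) (suc n) h + (moment (suc k) n (2 + h) + rootMoment k n h)
  moment-suc k n h = cong (_+_ (moment (suc k) (suc n) h)) (begin
    ∑F n (2 + h) (λ x → weight (graft x) C suc k)
      ≡⟨ ∑F-cong n (2 + h) (λ x _ → trans
           (cong (_C suc k) (weight-graft x)) (split (weight x) (rootMark-≤1 x))) ⟩
    ∑F n (2 + h) (λ x → weight x C suc k + rootMark x * (weight x C k))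
      ≡⟨ ∑F-+ n (2 + h) _ _ ⟩
    moment (suc k) n (2 + h) + rootMoment k n h ∎)
    where
    open ≡-Reasoning
    split : ∀ {e} w → e ≤ 1 → (e + w) C suc k ≡ w C suc k + e * (w C k)
    split {zero}     w _ = sym (+-identityʳ _)
    split {suc zero} w _ = begin
      suc w C suc k              ≡⟨ nCk+nC[k+1]≡[n+1]C[k+1] w k ⟨
      w C k + w C suc k          ≡⟨ +-comm (w C k) _ ⟩
      w C suc k + w C k          ≡⟨ cong (_+_ (w C suc k)) (*-identityˡ _) ⟨
      w C suc k + 1 * (w C k)    ∎
    split {suc (suc _)} w (s≤s ())

  emptyFirst-moment : ∀ k n h → ∑F n (suc h) (λ x → emptyAt zero x * (weight x C k)) ≡ moment k n h
  emptyFirst-moment k n h = ∑F-emptyAt n zero _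

  emptySecond-moment : ∀ k n h →
    ∑F n (2 + h) (λ x → emptyAt (suc zero) x * (weight x C k)) ≡ moment k n (suc h)
  emptySecond-moment k n h = trans
    (∑F-emptyAt n (suc zero) _)
    (∑F-cong n (suc h) λ { (F ∷ x) _ →
      -- The inserted empty forest only adds 0 to the offset of `F`.
      cong (λ o → (countChildren d i j o true F + weight x) C k) (+-identityʳ (total x)) })

  emptyBoth-moment : ∀ k n h →
    ∑F n (2 + h) (λ x → emptyAt zero x * emptyAt (suc zero) x * (weight x C k)) ≡ moment k n h
  emptyBoth-moment k n h = begin
    ∑F n (2 + h) (λ x → emptyAt zero x * emptyAt (suc zero) x * (weight x C k))
      ≡⟨ ∑F-cong n (2 + h) (λ x _ → *-assoc (emptyAt zero x) _ _) ⟩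
    ∑F n (2 + h) (λ x → emptyAt zero x * (emptyAt (suc zero) x * (weight x C k)))
      ≡⟨ ∑F-emptyAt n zero (λ x → emptyAt (suc zero) x * (weight x C k)) ⟩
    ∑F n (1 + h) (λ x → emptyAt zero x * (weight x C k))
      ≡⟨ emptyFirst-moment k n h ⟩
    moment k n h ∎
    where open ≡-Reasoning

  -- A marked root is a leaf here, which forces the first of the 2 + h forests to be empty.
  rootMoment-low : ∀ k {n} h → suc n ≤ i → suc n < d ∸ j → rootMoment k n h ≡ moment k n (suc h)
  rootMoment-low k {n} h low high = trans
    -- Matching the total with `refl` identifies the label of the removed root with `suc n`.
    (∑F-cong n (2 + h) λ { (F ∷ G ∷ x) refl →
      cong (_* (weight (F ∷ G ∷ x) C k)) (marked-low (null F) (null G) low high) })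
    (emptyFirst-moment k n (suc h))

  -- A marked root is a leftmost leaf here, which forces both leading forests to be empty.
  rootMoment-mid : ∀ k {n} h → i < suc n → suc n < d ∸ j → rootMoment k n h ≡ moment k n h
  rootMoment-mid k {n} h low high = trans
    (∑F-cong n (2 + h) λ { (F ∷ G ∷ x) refl →
      cong (_* (weight (F ∷ G ∷ x) C k)) (marked-mid (null F) (null G) low high) })
    (emptyBoth-moment k n h)

  -- A root is marked when either leading forest is empty; each single condition removes one forest,
  -- and their overlap removes two.
  rootMoment-high : ∀ k {n} h → d ∸ j ≤ suc n →
    rootMoment k n h + moment k n h ≡ moment k n (suc h) + moment k n (suc h)
  rootMoment-high k {n} h high = begin
    rootMoment k n h + moment k n h
      ≡⟨ cong (_+_ (rootMoment k n h)) (emptyBoth-moment k n h) ⟨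
    rootMoment k n h + _
      ≡⟨ ∑F-+ n (2 + h) _ _ ⟨
    ∑F n (2 + h) (λ x → rootMark x * (weight x C k) + emptyAt zero x * emptyAt (suc zero) x * (weight x C k))
      ≡⟨ ∑F-cong n (2 + h) (λ { x@(F ∷ G ∷ _) refl → begin
           rootMark x * (weight x C k) + bit (null F) * bit (null G) * (weight x C k)
             ≡⟨ *-distribʳ-+ (weight x C k) (rootMark x) _ ⟨
           (rootMark x + bit (null F) * bit (null G)) * (weight x C k)
             ≡⟨ cong (_* (weight x C k)) (marked-high (null F) (null G) high) ⟩
           (bit (null F) + bit (null G)) * (weight x C k)
             ≡⟨ *-distribʳ-+ (weight x C k) (bit (null F)) _ ⟩
           bit (null F) * (weight x C k) + bit (null G) * (weight x C k) ∎ }) ⟩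
    ∑F n (2 + h) (λ x → emptyAt zero x * (weight x C k) + emptyAt (suc zero) x * (weight x C k))
      ≡⟨ ∑F-+ n (2 + h) _ _ ⟩
    _
      ≡⟨ cong₂ _+_ (emptyFirst-moment k n (suc h)) (emptySecond-moment k n h) ⟩
    moment k n (suc h) + moment k n (suc h) ∎
    where open ≡-Reasoning

-- Closed form of the moments

module ClosedForm (d i j : ℕ) where
  open Moments d i j

  private
    T : ℕ → ℕ → ℕ → ℕ
    T = shiftedBinomialSum

  -- Among the n smallest labels, suc p are at most i and l are at least d ∸ j.
  Closed : ℕ → ℕ → ℕ → Set
  Closed p l n = ∀ k r h → r + k ≡ n → moment k n h ≡ ballot r h * T l (r + h + p + l) k

  module _ (p l n : ℕ) (closed : Closed p l n) where

    closed-at : ∀ k r h {N} → r + k ≡ n → r + h + p + l ≡ N → moment k n h ≡ ballot r h * T l N k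
    closed-at k r h r+k≡n refl = closed k r h r+k≡n

    -- For r = 0 the moment has order above n and vanishes, matching `ballotPred`. For positive r,
    -- replacing (r, h) by (r - 1, h + 2) raises the top entry by one.
    closed-pred : ∀ k r h {N} → r + k ≡ n → suc (r + h + p + l) ≡ N →
      moment (suc k) n (2 + h) ≡ ballotPred r (2 + h) * T l N (suc k)
    closed-pred k zero    h refl _    = moment-vanish (2 + h) (n<1+n k)
    closed-pred k (suc r) h r+k≡n eq =
      closed-at (suc k) r (2 + h) (trans (+-suc r k) r+k≡n) (trans (shift r h p l) eq)
      where
      shift : ∀ r h p l → r + (2 + h) + p + l ≡ suc (suc r + h + p + l)
      shift = solve-∀

  -- Moments of order zero are ballot numbers; for the others an inner induction on `h` leaves only
  -- the passage from `h` to `suc h`, whose last argument is the induction hypothesis.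
  closed-suc : ∀ p l n → p + l ≤ n →
    (∀ k r h → r + k ≡ n →
      moment (suc k) (suc n) h ≡ ballot r h * T l (r + h + p + l) (suc k) →
      moment (suc k) (suc n) (suc h) ≡ ballot r (suc h) * T l (suc (r + h + p + l)) (suc k)) →
    Closed p l (suc n)
  closed-suc p l n p+l≤n step zero r h r+0≡ = begin
    moment 0 (suc n) h                        ≡⟨ moment-0 (suc n) h ⟩
    ballot (suc n) h                          ≡⟨ cong (λ n → ballot n h) (trans (sym (+-identityʳ r)) r+0≡) ⟨
    ballot r h                                ≡⟨ *-identityʳ _ ⟨
    ballot r h * 1                            ≡⟨ cong (ballot r h *_) (shiftedBinomialSum-0 l (r + h + p + l)) ⟨
    ballot r h * T l (r + h + p + l) 0        ∎
    where open ≡-Reasoning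
  closed-suc p l n p+l≤n step (suc k) r h r+k≡ =
    go r h (suc-injective (trans (sym (+-suc r k)) r+k≡))
    where
    go : ∀ r h → r + k ≡ n → moment (suc k) (suc n) h ≡ ballot r h * T l (r + h + p + l) (suc k)
    -- No forests can hold `suc n` vertices, so the left side is 0; on the right the top entry p + l
    -- is at most n = k, hence below k + 1.
    go zero    zero    refl  =
      sym (trans (+-identityʳ _) (shiftedBinomialSum-vanish l (m≤n+m l p) (s≤s p+l≤n)))
    go (suc r) zero    r+k≡n = refl
    go r       (suc h) r+k≡n = trans (step k r h r+k≡n (go r h r+k≡n))
      (cong (λ N → ballot r (suc h) * T l N (suc k)) (shift r h p l))
      where
      shift : ∀ r h p l → suc (r + h + p + l) ≡ r + suc h + p + l
      shift = solve-∀

  -- The induction starts at one vertex rather than none, since `Closed` speaks of `suc p` labels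
  -- that are at most `i`.
  closed-low-first : 1 ≤ i → 1 < d ∸ j → Closed 0 0 1
  closed-low-first 1≤i 1<d-j = closed-suc 0 0 0 z≤n λ { zero zero h refl ih → begin
    moment 1 1 (suc h)
      ≡⟨ moment-suc 0 0 h ⟩
    moment 1 1 h + (moment 1 0 (2 + h) + rootMoment 0 0 h)
      ≡⟨ cong₂ _+_ ih (cong₂ _+_ (moment-vanish {1} {0} (2 + h) (n<1+n 0))
           (trans (rootMoment-low 0 h 1≤i 1<d-j) (moment-0 0 (suc h)))) ⟩
    1 * T 0 (h + 0 + 0) 1 + 1
      ≡⟨ cong (_+ 1) (*-identityˡ (T 0 (h + 0 + 0) 1)) ⟩
    T 0 (h + 0 + 0) 1 + T 0 (h + 0 + 0) 0
      ≡⟨ shiftedBinomialSum-pascal 0 {h + 0 + 0} 0 z≤n ⟨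
    T 0 (suc (h + 0 + 0)) 1
      ≡⟨ *-identityˡ (T 0 (suc (h + 0 + 0)) 1) ⟨
    1 * T 0 (suc (h + 0 + 0)) 1 ∎ }
    where open ≡-Reasoning

  -- The previous case has one low label fewer, which makes the top entry `X` in all three terms;
  -- the sum then factors into the ballot recurrence and Pascal's rule.
  closed-low-suc : ∀ {p} → 2 + p ≤ i → 2 + p < d ∸ j → Closed p 0 (suc p) → Closed (suc p) 0 (2 + p)
  closed-low-suc {p} low high closed = closed-suc (suc p) 0 (suc p) (≤-reflexive (+-identityʳ (suc p))) λ k r h r+k≡n ih →
    let X = r + h + suc p + 0 in begin
    moment (suc k) (2 + p) (suc h)
      ≡⟨ moment-suc k (suc p) h ⟩
    moment (suc k) (2 + p) h + (moment (suc k) (suc p) (2 + h) + rootMoment k (suc p) h)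
      ≡⟨ cong₂ _+_ ih (cong₂ _+_ (closed-pred p 0 (suc p) closed k r h r+k≡n (shift₁ r h p)) (trans
           (rootMoment-low k h low high) (closed-at p 0 (suc p) closed k r (suc h) r+k≡n (shift₂ r h p)))) ⟩
    ballot r h * T 0 X (suc k) + (ballotPred r (2 + h) * T 0 X (suc k) + ballot r (suc h) * T 0 X k)
      ≡⟨ cong (λ b → ballot r h * T 0 X (suc k) + (ballotPred r (2 + h) * T 0 X (suc k) + b * T 0 X k))
              (ballot-suc r h) ⟩
    ballot r h * T 0 X (suc k) + (ballotPred r (2 + h) * T 0 X (suc k) + (ballot r h + ballotPred r (2 + h)) * T 0 X k)
      ≡⟨ collect (ballot r h) (ballotPred r (2 + h)) (T 0 X (suc k)) (T 0 X k) ⟩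
    (ballot r h + ballotPred r (2 + h)) * (T 0 X (suc k) + T 0 X k)
      ≡⟨ cong₂ _*_ (ballot-suc r h) (shiftedBinomialSum-pascal 0 {X} k z≤n) ⟨
    ballot r (suc h) * T 0 (suc X) (suc k) ∎
    where
    open ≡-Reasoning
    shift₁ : ∀ r h p → suc (r + h + p + 0) ≡ r + h + suc p + 0
    shift₁ = solve-∀
    shift₂ : ∀ r h p → r + suc h + p + 0 ≡ r + h + suc p + 0
    shift₂ = solve-∀
    collect : ∀ a b s t → a * s + (b * s + (a + b) * t) ≡ (a + b) * (s + t)
    collect = solve-∀

  -- Pascal's rule combines the two terms carrying `ballot r h` into one with top entry `suc X`,
  -- which is already the top entry of the remaining term.
  closed-mid-suc : ∀ {p n} → p ≤ n → i < suc n → suc n < d ∸ j → Closed p 0 n → Closed p 0 (suc n)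
  closed-mid-suc {p} {n} p≤n low high closed =
    closed-suc p 0 n (≤-trans (≤-reflexive (+-identityʳ p)) p≤n) λ k r h r+k≡n ih →
    let X = r + h + p + 0 in begin
    moment (suc k) (suc n) (suc h)
      ≡⟨ moment-suc k n h ⟩
    moment (suc k) (suc n) h + (moment (suc k) n (2 + h) + rootMoment k n h)
      ≡⟨ cong₂ _+_ ih (cong₂ _+_ (closed-pred p 0 n closed k r h r+k≡n refl)
           (trans (rootMoment-mid k h low high) (closed k r h r+k≡n))) ⟩
    ballot r h * T 0 X (suc k) + (ballotPred r (2 + h) * T 0 (suc X) (suc k) + ballot r h * T 0 X k)
      ≡⟨ collect (ballot r h) (ballotPred r (2 + h)) (T 0 X (suc k)) (T 0 (suc X) (suc k)) (T 0 X k) ⟩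
    ballot r h * (T 0 X (suc k) + T 0 X k) + ballotPred r (2 + h) * T 0 (suc X) (suc k)
      ≡⟨ cong (λ t → ballot r h * t + ballotPred r (2 + h) * T 0 (suc X) (suc k))
              (shiftedBinomialSum-pascal 0 {X} k z≤n) ⟨
    ballot r h * T 0 (suc X) (suc k) + ballotPred r (2 + h) * T 0 (suc X) (suc k)
      ≡⟨ *-distribʳ-+ (T 0 (suc X) (suc k)) (ballot r h) (ballotPred r (2 + h)) ⟨
    (ballot r h + ballotPred r (2 + h)) * T 0 (suc X) (suc k)
      ≡⟨ cong (_* T 0 (suc X) (suc k)) (ballot-suc r h) ⟨
    ballot r (suc h) * T 0 (suc X) (suc k) ∎
    where
    open ≡-Reasoning
    collect : ∀ a b s u t → a * s + (b * u + a * t) ≡ a * (s + t) + b * u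
    collect = solve-∀

  -- The overlap term of inclusion-exclusion is b * u. It also appears when the induction hypothesis
  -- is split by `shiftedBinomialSum-suc`, so it cancels.
  closed-high-suc : ∀ {p l n} → p + suc l ≤ n → d ∸ j ≤ suc n → Closed p l n → Closed p (suc l) (suc n)
  closed-high-suc {p} {l} {n} p+l<n high closed = closed-suc p (suc l) n p+l<n λ k r h r+k≡n ih →
    let X = r + h + p + l
        b = ballot r h
        b′ = ballotPred r (2 + h)
        s = T l (suc X) (suc k)
        t = T l (suc X) k
        u = T l X k
        raise : ∀ {N} → r + h + p + suc l ≡ suc N → T (suc l) (r + h + p + suc l) (suc k) ≡
                T l (suc N) (suc k) + T l N k
        raise eq = trans (cong (λ N → T (suc l) N (suc k)) eq) (shiftedBinomialSum-suc l _ k)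
    in
    trans (+-cancelʳ-≡ (b * u) _ _ (begin
      moment (suc k) (suc n) (suc h) + b * u
        ≡⟨ cong₂ _+_ (moment-suc k n h) (sym (closed k r h r+k≡n)) ⟩
      moment (suc k) (suc n) h + (moment (suc k) n (2 + h) + rootMoment k n h) + moment k n h
        ≡⟨ reassoc (moment (suc k) (suc n) h) (moment (suc k) n (2 + h)) (rootMoment k n h) (moment k n h) ⟩
      moment (suc k) (suc n) h + (moment (suc k) n (2 + h) + (rootMoment k n h + moment k n h))
        ≡⟨ cong₂ _+_ (trans ih (cong (b *_) (raise (+-suc (r + h + p) l))))
             (cong₂ _+_ (closed-pred p l n closed k r h r+k≡n refl) (rootMoment-high k h high)) ⟩
      b * (s + u) + (b′ * s + (moment k n (suc h) + moment k n (suc h)))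
        ≡⟨ cong (λ m → b * (s + u) + (b′ * s + (m + m))) (trans
             (closed-at p l n closed k r (suc h) r+k≡n (shift r h p l))
             (cong (_* t) (ballot-suc r h))) ⟩
      b * (s + u) + (b′ * s + ((b + b′) * t + (b + b′) * t))
        ≡⟨ collect b b′ s t u ⟩
      (b + b′) * (s + t + t) + b * u ∎))
    -- The target splits once in l and once by Pascal's rule, which produces `t` twice: once for
    -- each of the two ways to be marked.
    (sym (cong₂ _*_ (ballot-suc r h) (begin
      T (suc l) (suc (r + h + p + suc l)) (suc k)
        ≡⟨ cong (λ N → T (suc l) (suc N) (suc k)) (+-suc (r + h + p) l) ⟩
      T (suc l) (suc (suc X)) (suc k)
        ≡⟨ shiftedBinomialSum-suc l (suc X) k ⟩
      T l (suc (suc X)) (suc k) + t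
        ≡⟨ cong (_+ t) (shiftedBinomialSum-pascal l {suc X} k (m≤n⇒m≤1+n (m≤n+m l (r + h + p)))) ⟩
      s + t + t ∎)))
    where
    open ≡-Reasoning
    reassoc : ∀ a b c e → a + (b + c) + e ≡ a + (b + (c + e))
    reassoc = solve-∀
    shift : ∀ r h p l → r + suc h + p + l ≡ suc (r + h + p + l)
    shift = solve-∀
    collect : ∀ b b′ s t u →
      b * (s + u) + (b′ * s + ((b + b′) * t + (b + b′) * t)) ≡ (b + b′) * (s + t + t) + b * u
    collect = solve-∀

-- The three label ranges in succession

module _ (i q j : ℕ) where
  private
    n d : ℕ
    -- The non-root labels 1, ..., n consist of `suc i` low, then `q` middle, then `j` high ones;
    -- the label `d` belongs to the root.
    n = suc i + q + j
    d = suc n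
  open Moments d (suc i) j
  open ClosedForm d (suc i) j

  private
    d∸j : d ∸ j ≡ suc (suc i + q)
    d∸j = m+n∸n≡m (suc (suc i + q)) j

    below : ∀ {l} → l ≤ suc i + q → l < d ∸ j
    below {l} l≤ = subst (l <_) (sym d∸j) (s≤s l≤)

  closed-low : ∀ p → p ≤ i → Closed p 0 (suc p)
  closed-low zero    p≤i = closed-low-first (s≤s z≤n) (below (s≤s z≤n))
  closed-low (suc p) p<i =
    closed-low-suc (s≤s p<i) (below (s≤s (≤-trans p<i (m≤m+n i q)))) (closed-low p (<⇒≤ p<i))

  closed-mid : ∀ e → e ≤ q → Closed i 0 (suc i + e)
  closed-mid zero    e≤q = subst (Closed i 0) (sym (+-identityʳ (suc i))) (closed-low i ≤-refl)
  closed-mid (suc e) e<q = subst (Closed i 0) (sym (+-suc (suc i) e)) (closed-mid-suc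
    (m≤n⇒m≤1+n (m≤m+n i e)) (s≤s (m≤m+n (suc i) e))
    (below (subst (_≤ suc i + q) (+-suc (suc i) e) (+-monoʳ-≤ (suc i) e<q)))
    (closed-mid e (<⇒≤ e<q)))

  closed-high : ∀ l → Closed i l (suc i + q + l)
  closed-high zero    = subst (Closed i 0) (sym (+-identityʳ (suc i + q))) (closed-mid q ≤-refl)
  closed-high (suc l) = subst (Closed i (suc l)) (sym (+-suc (suc i + q) l)) (closed-high-suc
    (≤-trans (≤-reflexive (+-suc i l)) (s≤s (+-monoˡ-≤ l (m≤m+n i q))))
    (≤-trans (≤-reflexive d∸j) (s≤s (m≤m+n (suc i + q) l)))
    (closed-high l))

  -- A plane tree on d vertices is a root over one forest with n vertices, so the closed form is
  -- taken at h = 1 and r = n - k.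
  moment≡catalan*innerSum : ∀ {k} → k < d → moment k n 1 ≡ catalan (d ∸ 1 ∸ k) * innerSum d (suc i) j k
  moment≡catalan*innerSum {k} k<d = begin
    moment k n 1
      ≡⟨ closed-high j k (n ∸ k) 1 (m∸n+n≡m k≤n) ⟩
    ballot (n ∸ k) 1 * shiftedBinomialSum j (n ∸ k + 1 + i + j) k
      ≡⟨ cong₂ _*_ (ballot-catalan (n ∸ k)) (cong (λ N → shiftedBinomialSum j N k) top) ⟩
    catalan (n ∸ k) * shiftedBinomialSum j (n + suc i + j ∸ k) k
      ≡⟨ cong (catalan (n ∸ k) *_) (innerSum≡shiftedBinomialSum d (suc i) j k) ⟨
    catalan (n ∸ k) * innerSum d (suc i) j k ∎
    where
    open ≡-Reasoning
    k≤n : k ≤ n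
    k≤n = s≤s⁻¹ k<d
    shift : ∀ r i j → r + 1 + i + j ≡ r + (suc i + j)
    shift = solve-∀
    top : n ∸ k + 1 + i + j ≡ n + suc i + j ∸ k
    top = begin
      n ∸ k + 1 + i + j       ≡⟨ shift (n ∸ k) i j ⟩
      n ∸ k + (suc i + j)     ≡⟨ +-∸-comm (suc i + j) k≤n ⟨
      n + (suc i + j) ∸ k     ≡⟨ cong (_∸ k) (+-assoc n (suc i) j) ⟨
      n + suc i + j ∸ k       ∎

-- From moments to coefficients

-- Exchanges the sum over `k` with the sum over forests, so that an identity for each single forest
-- passes to the moments.
∑F-linear : ∀ n h D (φ : ℕ → Forests h → ℕ) (ψ : Forests h → ℕ) (a : ℕ → ℤ) →
  (∀ x → total x ≡ n → ℤ-Sum.∑< D (λ k → + φ k x ℤ.* a k) ≡ + ψ x) →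
  ℤ-Sum.∑< D (λ k → + ∑F n h (φ k) ℤ.* a k) ≡ + ∑F n h ψ
∑F-linear zero    zero    D φ ψ a eq = eq [] refl
∑F-linear (suc n) zero    D φ ψ a eq =
  trans (ℤ-Sum.∑<-cong D λ k _ → ℤ.*-zeroˡ (a k)) (ℤ-Sum.∑<-ε D)
∑F-linear zero    (suc h) D φ ψ a eq =
  ∑F-linear zero h D (λ k → φ k ∘ ([] ∷_)) (ψ ∘ ([] ∷_)) a
    λ x x≡ → eq ([] ∷ x) (trans (+-identityʳ _) x≡)
∑F-linear (suc n) (suc h) D φ ψ a eq = begin
  ℤ-Sum.∑< D (λ k → + (A k + B k) ℤ.* a k)
    ≡⟨ ℤ-Sum.∑<-cong D (λ k _ → ℤ.*-distribʳ-+ (a k) (+ A k) (+ B k)) ⟩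
  ℤ-Sum.∑< D (λ k → + A k ℤ.* a k ℤ.+ + B k ℤ.* a k)
    ≡⟨ ℤ-Sum.∑<-∙ D (λ k → + A k ℤ.* a k) (λ k → + B k ℤ.* a k) ⟩
  ℤ-Sum.∑< D (λ k → + A k ℤ.* a k) ℤ.+ ℤ-Sum.∑< D (λ k → + B k ℤ.* a k)
    ≡⟨ cong₂ ℤ._+_
         (∑F-linear (suc n) h D (λ k → φ k ∘ ([] ∷_)) (ψ ∘ ([] ∷_)) a
           λ x x≡ → eq ([] ∷ x) (trans (+-identityʳ _) x≡))
         (∑F-linear n (2 + h) D (λ k → φ k ∘ graft) (ψ ∘ graft) a
           λ x x≡ → eq (graft x) (trans (total-graft x) (cong suc x≡))) ⟩
  + ∑F (suc n) (suc h) ψ ∎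
  where
  open ≡-Reasoning
  A B : ℕ → ℕ
  A k = ∑F (suc n) h (φ k ∘ ([] ∷_))
  B k = ∑F n (2 + h) (φ k ∘ graft)

δ-refl : ∀ a → δ a a ≡ 1
δ-refl a = cong bit (dec-true (a ≟ a) refl)

δ-≢ : ∀ {a b} → ¬ a ≡ b → δ a b ≡ 0
δ-≢ {a} {b} a≢b = cong bit (dec-false (a ≟ b) a≢b)

-- Truncated subtraction from `d` is injective on numbers up to `d`.
δ-∸ : ∀ {w m d} → w ≤ d → m ≤ d → δ (d ∸ w) (d ∸ m) ≡ δ w m
δ-∸ {w} {m} {d} w≤d m≤d with w ≟ m
... | yes refl = trans (δ-refl (d ∸ m)) (sym (δ-refl m))
... | no  w≢m  = trans (δ-≢ (w≢m ∘ ∸-cancelˡ-≡ w≤d m≤d)) (sym (δ-≢ w≢m))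

coeff-f≡∑F : ∀ i q j {m} → let n = suc i + q + j; d = suc n in m ≤ d →
  coeff (f d (suc i) j) (d ∸ m) ≡ + ∑F n 1 (λ x → δ (Moments.weight d (suc i) j x) m)
coeff-f≡∑F i q j {m} m≤d = begin
  coeff (f d (suc i) j) (d ∸ m)
    ≡⟨ coeff-f d (suc i) j (d ∸ m) ⟩
  ℤ-Sum.∑< d (λ k → + (catalan (d ∸ 1 ∸ k) * innerSum d (suc i) j k) ℤ.* a k)
    ≡⟨ ℤ-Sum.∑<-cong d (λ k k<d → cong (λ c → + c ℤ.* a k) (moment≡catalan*innerSum i q j k<d)) ⟨
  ℤ-Sum.∑< d (λ k → + moment k n 1 ℤ.* a k)
    ≡⟨ ∑F-linear n 1 d (λ k x → weight x C k) (λ x → δ (weight x) m) a (λ x x≡n →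
         -- The weight is at most n < d, so the range k < d contains the whole binomial expansion.
         let w≤n = ≤-trans (weight-≤ x) (≤-reflexive x≡n) in
         trans (∑-binomial-mixedPower (s≤s w≤n) (m≤n⇒m≤1+n w≤n) (d ∸ m))
               (cong +_ (δ-∸ (m≤n⇒m≤1+n w≤n) m≤d))) ⟩
  + ∑F n 1 (λ x → δ (weight x) m) ∎
  where
  open ≡-Reasoning
  n d : ℕ
  n = suc i + q + j
  d = suc n
  open Moments d (suc i) j
  a : ℕ → ℤ
  a k = coeff (mixedPower k (d ∸ k)) (d ∸ m)

-- Enumeration

-- The decomposition behind the recursion of `∑F`: the first forest is empty, or its last tree is
-- split off and its root removed.
⊎↔Forests : ∀ {h} → (Forests h ⊎ Forests (2 + h)) ↔ Forests (1 + h)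
⊎↔Forests {h} = mk↔ₛ′ to from to∘from from∘to
  where
  to : Forests h ⊎ Forests (2 + h) → Forests (1 + h)
  to (inj₁ x) = [] ∷ x
  to (inj₂ x) = graft x

  -- The view is a separate argument so that `from∘to` can replace it by the known view of an
  -- appended list.
  cut : ∀ {F} → InitLast F → Forests h → Forests h ⊎ Forests (2 + h)
  cut []              x = inj₁ x
  cut (G ∷ʳ′ node F)  x = inj₂ (F ∷ G ∷ x)

  from : Forests (1 + h) → Forests h ⊎ Forests (2 + h)
  from (F ∷ x) = cut (initLast F) x

  to∘cut : ∀ {F} (v : InitLast F) x → to (cut v x) ≡ F ∷ x
  to∘cut []             x = refl
  to∘cut (G ∷ʳ′ node F) x = refl

  to∘from : ∀ x → to (from x) ≡ x
  to∘from (F ∷ x) = to∘cut (initLast F) x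

  initLast-∷ʳ : ∀ F (t : PlaneTree) → initLast (F ∷ʳ t) ≡ F ∷ʳ′ t
  initLast-∷ʳ []      t = refl
  initLast-∷ʳ (u ∷ F) t rewrite initLast-∷ʳ F t = refl

  from∘to : ∀ y → from (to y) ≡ y
  from∘to (inj₁ x)           = refl
  from∘to (inj₂ (F ∷ G ∷ x)) = cong (λ v → cut v x) (initLast-∷ʳ G (node F))

Prop-↔ : ∀ {a b} {A : Set a} {B : Set b} →
  (∀ (x y : A) → x ≡ y) → (∀ (x y : B) → x ≡ y) → (A → B) → (B → A) → A ↔ B
Prop-↔ irrA irrB to from = mk↔ₛ′ to from (λ y → irrB (to (from y)) y) (λ x → irrA (from (to x)) x)

≡-↔ : ∀ {a b c d : ℕ} → (a ≡ b → c ≡ d) → (c ≡ d → a ≡ b) → (a ≡ b) ↔ (c ≡ d)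
≡-↔ = Prop-↔ ≡-irrelevant ≡-irrelevant

ForestsWith : ∀ n h → (Forests h → ℕ) → ℕ → Set
ForestsWith n h w m = Σ (Forests h) λ x → total x ≡ n × w x ≡ m

Fin-δ : ∀ a m → Fin (δ a m) ↔ (a ≡ m)
Fin-δ a m with a ≟ m
... | yes refl = subst (λ N → Fin N ↔ (a ≡ a)) (sym (δ-refl a))
  (Prop-↔ (λ { zero zero → refl }) ≡-irrelevant (λ _ → refl) (λ _ → zero))
... | no  a≢m  = subst (λ N → Fin N ↔ (a ≡ m)) (sym (δ-≢ a≢m))
  (Prop-↔ (λ ()) ≡-irrelevant (λ ()) (λ a≡m → contradiction a≡m a≢m))

-- Here `n` stays arbitrary, so the same decomposition serves n = 0, where the second summand is
-- empty, and positive n.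
ForestsWith-suc : ∀ {n} h (w : Forests (suc h) → ℕ) m →
  ForestsWith n (suc h) w m ↔
  (ForestsWith n h (w ∘ ([] ∷_)) m ⊎ Σ (Forests (2 + h)) λ x → suc (total x) ≡ n × w (graft x) ≡ m)
ForestsWith-suc h w m =
  ↔-trans (↔-sym (Σ-↔ ⊎↔Forests ↔-refl)) (↔-trans Σ-distribʳ-⊎
    (Σ-↔ ↔-refl (λ {x} → ≡-↔ (trans (sym (+-identityʳ (total x)))) (trans (+-identityʳ (total x)))
      ×-↔ ↔-refl)
     ⊎-↔
     Σ-↔ ↔-refl (λ {x} → ≡-↔ (trans (sym (total-graft x))) (trans (total-graft x)) ×-↔ ↔-refl)))

-- A sum of Kronecker deltas is a cardinality; the sums in the recursion of `∑F` become disjoint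
-- unions.
∑F-↔ : ∀ n h (w : Forests h → ℕ) m → Fin (∑F n h (λ x → δ (w x) m)) ↔ ForestsWith n h w m
∑F-↔ zero zero w m = ↔-trans (Fin-δ (w []) m)
  (mk↔ₛ′ (λ w≡m → [] , refl , w≡m) (λ { ([] , _ , w≡m) → w≡m })
         (λ { ([] , refl , w≡m) → refl }) (λ _ → refl))
∑F-↔ (suc n) zero w m = mk↔ₛ′ (λ ()) (λ { ([] , () , _) }) (λ { ([] , () , _) }) (λ ())
∑F-↔ zero (suc h) w m = ↔-trans (∑F-↔ zero h (w ∘ ([] ∷_)) m) (↔-trans
  (mk↔ₛ′ inj₁ (λ { (inj₁ x) → x ; (inj₂ (_ , () , _)) })
         (λ { (inj₁ x) → refl ; (inj₂ (_ , () , _)) }) (λ _ → refl))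
  (↔-sym (ForestsWith-suc h w m)))
∑F-↔ (suc n) (suc h) w m = ↔-trans +↔⊎ (↔-trans
  (∑F-↔ (suc n) h (w ∘ ([] ∷_)) m ⊎-↔ ↔-trans (∑F-↔ n (2 + h) (w ∘ graft) m)
    (Σ-↔ ↔-refl (≡-↔ (cong suc) suc-injective ×-↔ ↔-refl)))
  (↔-sym (ForestsWith-suc h w m)))

ForestsWith↔PlaneTree : ∀ d i j n m →
  ForestsWith n 1 (Moments.weight d i j) m ↔
  Σ PlaneTree (λ t → size t ≡ suc n × specialCount d i j t ≡ m)
ForestsWith↔PlaneTree d i j n m = Σ-↔
  (mk↔ₛ′ (λ { (F ∷ []) → node F }) (λ { (node F) → F ∷ [] })
         (λ { (node F) → refl }) (λ { (F ∷ []) → refl }))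
  (λ { {F ∷ []} → ≡-↔ (cong suc) suc-injective ×-↔
         ≡-↔ (trans (sym (+-identityʳ _))) (trans (+-identityʳ _)) })

theorem3p13 : (d i j : ℕ) → 2 ≤ d → 1 ≤ i → j < d ∸ 1 → i + j ≤ d ∸ 1 →
    (m : ℕ) → m ≤ d →
    ∃ λ (N : ℕ) →
    (coeff (f d i j) (d ∸ m) ≡ + N) ×
    (Fin N ↔ Σ PlaneTree (λ t → size t ≡ d × specialCount d i j t ≡ m))
theorem3p13 (suc n) (suc i) j _ _ _ i+j≤n m m≤d =
  -- From i + j ≤ d - 1 there are `q` middle labels, and n takes the form required above. The bound
  -- on `m` is transported together with the goal.
  subst (λ n → m ≤ suc n → Goal n) n≡ (λ m≤d′ →
    _ , coeff-f≡∑F i q j m≤d′ , ↔-trans (∑F-↔ _ 1 _ m) (ForestsWith↔PlaneTree _ (suc i) j _ m)) m≤d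
  where
  q : ℕ
  q = n ∸ (suc i + j)
  Goal : ℕ → Set
  Goal n = ∃ λ (N : ℕ) →
    (coeff (f (suc n) (suc i) j) (suc n ∸ m) ≡ + N) ×
    (Fin N ↔ Σ PlaneTree (λ t → size t ≡ suc n × specialCount (suc n) (suc i) j t ≡ m))
  swap : ∀ i j q → i + q + j ≡ q + (i + j)
  swap = solve-∀
  n≡ : suc i + q + j ≡ n
  n≡ = trans (swap (suc i) j q) (m∸n+n≡m i+j≤n)
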